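{- Let $n\geq 3$ and let $CAG_n=\mathrm{Cay}(A_n,T_3)$ be the complete alternating group graph, where $T_3=\{(i,j,k),(i,k,j)\mid 1\leq i<j<k\leq n\}$ is the set of all 3-cycles. Then the two largest eigenvalues of $CAG_n$ are $\lambda_1(CAG_n)=2\binom{n}{3}$ and $\lambda_2(CAG_n)=\frac{1}{3}n(n-2)(n-4)$.
   Context: $A_n$ is the alternating group on $\{1,\ldots,n\}$; $(i,j,k)$ denotes the 3-cycle $i\mapsto j\mapsto k\mapsto i$. Products of permutations are read left to right: $\sigma\tau$ means first apply $\sigma$, then $\tau$. For a finite group $\Gamma$ with identity $e$ and a subset $T\subseteq\Gamma\setminus\{e\}$ with $T=T^{ -1}$, the Cayley graph $\mathrm{Cay}(\Gamma,T)$ is the undirected graph with vertex set $\Gamma$ and edge set $\{\{\gamma,t\gamma\}\mid \gamma\in\Gamma,\ t\in T\}$. The eigenvalues of a graph $G$ on $N$ vertices are those of its adjacency matrix, listed with multiplicity as $\lambda_1(G)\geq\lambda_2(G)\geq\cdots\geq\lambda_N(G)$. -}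

module Defs where

open import Algebra.Bundles using (CommutativeRing; Group)
import Algebra.Definitions.RawMonoid as RawMonoidDefs
open import Data.Bool.Base using (if_then_else_)
open import Data.Fin.Base using (Fin) renaming (_<_ to _<ᶠ_)
open import Data.Fin.Permutation as Perm
  using (Permutation′; _⟨$⟩ʳ_; _⟨$⟩ˡ_; _∘ₚ_; flip)
open import Data.Fin.Permutation.Transposition.List using (TranspositionList; eval)
open import Data.Fin.Properties using (any?; all?; <-irrefl) renaming (_≟_ to _≟ᶠ_; _<?_ to _<ᶠ?_)
open import Data.List.Base using (List; []; _∷_; _++_; length; filter)
open import Data.List.Properties using (length-++)
open import Data.List.Relation.Unary.All using (All; []; _∷_)
open import Data.List.Relation.Unary.All.Properties using (++⁺)
open import Data.List.Relation.Unary.Linked using (Linked)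
open import Data.Nat.Base using (ℕ; suc)
open import Data.Nat.Divisibility using (_∣_; divides-refl; ∣m∣n⇒∣m+n)
open import Data.Nat.Properties using (+-comm)
open import Data.Product.Base using (Σ; ∃-syntax; _×_; _,_; uncurry)
open import Data.Sum.Base using (_⊎_; inj₁; inj₂)
open import Data.Vec.Functional using (Vector)
open import Function.Base using (_∘_)
open import Function.Bundles using (Inverse)
open import Level using (Level; _⊔_; 0ℓ) renaming (suc to lsuc)
open import Relation.Binary.Bundles using (Setoid)
open import Relation.Binary.Core using (Rel)
open import Relation.Binary.Definitions using (Decidable; Symmetric; _Respects_)
open import Relation.Binary.PropositionalEquality as ≡ using (_≡_; _≢_)
open import Relation.Binary.Structures using (IsDecTotalOrder)
open import Relation.Nullary using (¬_; does; ¬?)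
open import Relation.Nullary.Decidable using (map′; _×-dec_; _⊎-dec_; _→-dec_)
open import Relation.Unary using (Pred) renaming (Decidable to Decidable₁)

-- Ordered fields with decidable order; classically ℝ is one of them.
-- As x ≈ 0 is decidable the inverse can be total; its value at 0 is
-- left unspecified.

record OrderedField (c ℓ₁ ℓ₂ : Level) : Set (lsuc (c ⊔ ℓ₁ ⊔ ℓ₂)) where
  field
    commutativeRing : CommutativeRing c ℓ₁

  open CommutativeRing commutativeRing public

  infix 4 _≤_
  infix 8 _⁻¹

  field
    _≤_             : Rel Carrier ℓ₂
    isDecTotalOrder : IsDecTotalOrder _≈_ _≤_
    +-monoʳ-≤       : ∀ {x y} z → x ≤ y → z + x ≤ z + y
    *-nonNegative   : ∀ {x y} → 0# ≤ x → 0# ≤ y → 0# ≤ x * y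
    0≉1             : ¬ (0# ≈ 1#)
    _⁻¹             : Carrier → Carrier
    ⁻¹-cong         : ∀ {x y} → x ≈ y → x ⁻¹ ≈ y ⁻¹
    ⁻¹-inverse      : ∀ x → ¬ (x ≈ 0#) → x * x ⁻¹ ≈ 1#

  open IsDecTotalOrder isDecTotalOrder public using (_≟_; _≤?_)

  open RawMonoidDefs +-rawMonoid public using (sum)

  fromℕ : ℕ → Carrier
  fromℕ m = RawMonoidDefs._×_ +-rawMonoid m 1#

record Graph (v ℓ e : Level) : Set (lsuc (v ⊔ ℓ ⊔ e)) where
  field
    vertices : Setoid v ℓ

  open Setoid vertices public using () renaming (Carrier to Vertex; _≈_ to _≈ᵛ_)

  infix 4 _∼_

  field
    _∼_   : Rel Vertex e
    _∼?_  : Decidable _∼_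
    ∼-resp : ∀ {u u′ w w′} → u ≈ᵛ u′ → w ≈ᵛ w′ → u ∼ w → u′ ∼ w′
    ∼-sym : Symmetric _∼_
    ∼-irrefl : ∀ {u} → ¬ (u ∼ u)

  -- A numbering of the vertices; in particular the graph has N of them.
  Labelling : ℕ → Set (v ⊔ ℓ)
  Labelling N = Inverse (≡.setoid (Fin N)) vertices

-- The edges are the pairs {γ , tγ}; since T = T⁻¹ it is immaterial which
-- endpoint is called γ, so γ ∼ δ only asks for δ = tγ.

module _ {a ℓ p : Level} (Γ : Group a ℓ) where
  open Group Γ

  Cay : (T : Pred Carrier p) → Decidable₁ T → T Respects _≈_ →
        ¬ T ε → (∀ {t} → T t → T (t ⁻¹)) → Graph a ℓ (a ⊔ ℓ ⊔ p)
  Cay T T? T-resp ε∉T T⁻¹ = record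
    { vertices = setoid
    ; _∼_      = λ γ δ → ∃[ t ] T t × δ ≈ t ∙ γ
    ; _∼?_     = λ γ δ → map′
        (λ Tδγ⁻¹ → δ ∙ γ ⁻¹ , Tδγ⁻¹ , sym (undivide γ δ))
        (λ (t , Tt , δ≈tγ) → T-resp (sym (divide δ≈tγ)) Tt)
        (T? (δ ∙ γ ⁻¹))
    ; ∼-resp   = λ u≈u′ w≈w′ (t , Tt , w≈tu) →
        t , Tt , trans (sym w≈w′) (trans w≈tu (∙-congˡ u≈u′))
    ; ∼-sym    = λ { {γ} {δ} (t , Tt , δ≈tγ) → t ⁻¹ , T⁻¹ Tt ,
        sym (trans (∙-congˡ δ≈tγ) (trans (sym (assoc (t ⁻¹) t γ))
          (trans (∙-congʳ (inverseˡ t)) (identityˡ γ)))) }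
    ; ∼-irrefl = λ { {γ} (t , Tt , γ≈tγ) →
        ε∉T (T-resp (trans (sym (divide γ≈tγ)) (inverseʳ γ)) Tt) }
    }
    where
    divide : ∀ {γ δ t} → δ ≈ t ∙ γ → δ ∙ γ ⁻¹ ≈ t
    divide {γ} {δ} {t} δ≈tγ =
      trans (∙-congʳ δ≈tγ) (trans (assoc t γ (γ ⁻¹))
        (trans (∙-congˡ (inverseʳ γ)) (identityʳ t)))
    undivide : ∀ γ δ → (δ ∙ γ ⁻¹) ∙ γ ≈ δ
    undivide γ δ = trans (assoc δ (γ ⁻¹) γ)
      (trans (∙-congˡ (inverseˡ γ)) (identityʳ δ))

-- Even permutations: products of an even number of transpositions.  The
-- library's lists also allow the degenerate transposition (i i), which
-- must be excluded here.

module _ {n : ℕ} where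

  IsEven : Pred (Permutation′ n) 0ℓ
  IsEven π = Σ (TranspositionList n) λ ts →
    All (uncurry _≢_) ts × 2 ∣ length ts × π Perm.≈ eval ts

  eval-++ : ∀ (ss ts : TranspositionList n) → eval (ss ++ ts) Perm.≈ eval ss ∘ₚ eval ts
  eval-++ []             ts x = ≡.refl
  eval-++ ((i , j) ∷ ss) ts x = eval-++ ss ts (Perm.transpose i j ⟨$⟩ʳ x)

  invert : ∀ (ts : TranspositionList n) → All (uncurry _≢_) ts →
           Σ (TranspositionList n) λ ts′ → All (uncurry _≢_) ts′ ×
             length ts′ ≡ length ts × flip (eval ts) Perm.≈ eval ts′
  invert []             []            = [] , [] , ≡.refl , λ _ → ≡.refl
  invert ((i , j) ∷ ts) (i≢j ∷ all) with invert ts all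
  ... | ts′ , all′ , len , eq =
    ts′ ++ (j , i) ∷ [] , ++⁺ all′ ((i≢j ∘ ≡.sym) ∷ []) ,
    ≡.trans (length-++ ts′) (≡.trans (+-comm (length ts′) 1) (≡.cong suc len)) ,
    λ x → ≡.trans (≡.cong (Perm.transpose j i ⟨$⟩ʳ_) (eq x))
                  (≡.sym (eval-++ ts′ ((j , i) ∷ []) x))

  flip-cong : ∀ {π ρ : Permutation′ n} → π Perm.≈ ρ → flip π Perm.≈ flip ρ
  flip-cong {π} {ρ} π≈ρ x = ≡.trans
    (≡.cong (π ⟨$⟩ˡ_) (≡.trans (≡.sym (Perm.inverseʳ ρ)) (≡.sym (π≈ρ (ρ ⟨$⟩ˡ x)))))
    (Perm.inverseˡ π)

  id-even : IsEven Perm.id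
  id-even = [] , [] , divides-refl 0 , λ _ → ≡.refl

  ∘-even : ∀ {π ρ} → IsEven π → IsEven ρ → IsEven (π ∘ₚ ρ)
  ∘-even {π} {ρ} (ss , ss≢ , 2∣ss , π≈) (ts , ts≢ , 2∣ts , ρ≈) =
    ss ++ ts , ++⁺ ss≢ ts≢ ,
    ≡.subst (2 ∣_) (≡.sym (length-++ ss)) (∣m∣n⇒∣m+n 2∣ss 2∣ts) ,
    λ x → ≡.trans (≡.cong (ρ ⟨$⟩ʳ_) (π≈ x))
            (≡.trans (ρ≈ (eval ss ⟨$⟩ʳ x)) (≡.sym (eval-++ ss ts x)))

  flip-even : ∀ {π} → IsEven π → IsEven (flip π)
  flip-even {π} (ts , ts≢ , 2∣ts , π≈) with invert ts ts≢
  ... | ts′ , ts′≢ , len , eq =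
    ts′ , ts′≢ , ≡.subst (2 ∣_) (≡.sym len) 2∣ts ,
    λ x → ≡.trans (flip-cong {π} {eval ts} π≈ x) (eq x)

-- π ∘ₚ ρ applies π first.

A : ℕ → Group 0ℓ 0ℓ
A n = record
  { Carrier = Σ (Permutation′ n) IsEven
  ; _≈_     = λ (π , _) (ρ , _) → π Perm.≈ ρ
  ; _∙_     = λ (π , πe) (ρ , ρe) → π ∘ₚ ρ , ∘-even {n} {π} {ρ} πe ρe
  ; ε       = Perm.id , id-even
  ; _⁻¹     = λ (π , πe) → flip π , flip-even {n} {π} πe
  ; isGroup = record
    { isMonoid = record
      { isSemigroup = record
        { isMagma = record
          { isEquivalence = record
            { refl  = λ _ → ≡.refl
            ; sym   = λ π≈ρ x → ≡.sym (π≈ρ x)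
            ; trans = λ π≈ρ ρ≈σ x → ≡.trans (π≈ρ x) (ρ≈σ x)
            }
          ; ∙-cong = λ { {_} {_} {_} {τ , _} π≈ρ σ≈τ x →
              ≡.trans (σ≈τ _) (≡.cong (τ ⟨$⟩ʳ_) (π≈ρ x)) }
          }
        ; assoc = λ _ _ _ _ → ≡.refl
        }
      ; identity = (λ _ _ → ≡.refl) , (λ _ _ → ≡.refl)
      }
    ; inverse = (λ (π , _) _ → Perm.inverseʳ π) , (λ (π , _) _ → Perm.inverseˡ π)
    ; ⁻¹-cong = λ { {π , _} {ρ , _} π≈ρ → flip-cong {n} {π} {ρ} π≈ρ }
    }
  }

module _ {n : ℕ} where

  -- π is the cycle (i , j , k); meaningful for distinct i, j, k.
  IsCycle : Fin n → Fin n → Fin n → Pred (Permutation′ n) 0ℓ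
  IsCycle i j k π =
    (π ⟨$⟩ʳ i ≡ j) × (π ⟨$⟩ʳ j ≡ k) × (π ⟨$⟩ʳ k ≡ i) ×
    (∀ x → x ≢ i → x ≢ j → x ≢ k → π ⟨$⟩ʳ x ≡ x)

  T₃ : Pred (Group.Carrier (A n)) 0ℓ
  T₃ (π , _) = ∃[ i ] ∃[ j ] ∃[ k ]
    (i <ᶠ j × j <ᶠ k × (IsCycle i j k π ⊎ IsCycle i k j π))

  isCycle? : ∀ i j k → Decidable₁ (IsCycle i j k)
  isCycle? i j k π =
    (π ⟨$⟩ʳ i ≟ᶠ j) ×-dec (π ⟨$⟩ʳ j ≟ᶠ k) ×-dec (π ⟨$⟩ʳ k ≟ᶠ i) ×-dec
    all? (λ x → ¬? (x ≟ᶠ i) →-dec (¬? (x ≟ᶠ j) →-dec (¬? (x ≟ᶠ k) →-dec (π ⟨$⟩ʳ x ≟ᶠ x))))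

  T₃? : Decidable₁ T₃
  T₃? (π , _) = any? λ i → any? λ j → any? λ k →
    (i <ᶠ? j) ×-dec (j <ᶠ? k) ×-dec (isCycle? i j k π ⊎-dec isCycle? i k j π)

  isCycle-resp : ∀ {i j k} → IsCycle i j k Respects Perm._≈_
  isCycle-resp π≈ρ (i↦j , j↦k , k↦i , fixed) =
    ≡.trans (≡.sym (π≈ρ _)) i↦j , ≡.trans (≡.sym (π≈ρ _)) j↦k ,
    ≡.trans (≡.sym (π≈ρ _)) k↦i ,
    λ x x≢i x≢j x≢k → ≡.trans (≡.sym (π≈ρ x)) (fixed x x≢i x≢j x≢k)

  T₃-resp : T₃ Respects Group._≈_ (A n)
  T₃-resp {π , _} {ρ , _} π≈ρ (i , j , k , i<j , j<k , inj₁ c) =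
    i , j , k , i<j , j<k , inj₁ (isCycle-resp {i} {j} {k} {π} {ρ} π≈ρ c)
  T₃-resp {π , _} {ρ , _} π≈ρ (i , j , k , i<j , j<k , inj₂ c) =
    i , j , k , i<j , j<k , inj₂ (isCycle-resp {i} {k} {j} {π} {ρ} π≈ρ c)

  ε∉T₃ : ¬ T₃ (Group.ε (A n))
  ε∉T₃ (i , j , k , i<j , j<k , inj₁ (i≡j , _))           = <-irrefl i≡j i<j
  ε∉T₃ (i , j , k , i<j , j<k , inj₂ (_ , _ , j≡i , _)) = <-irrefl (≡.sym j≡i) i<j

  isCycle-flip : ∀ {i j k} (π : Permutation′ n) → IsCycle i j k π → IsCycle i k j (flip π)
  isCycle-flip π (i↦j , j↦k , k↦i , fixed) =
    back k↦i , back j↦k , back i↦j ,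
    λ x x≢i x≢k x≢j → back (fixed x x≢i x≢j x≢k)
    where
    back : ∀ {x y} → π ⟨$⟩ʳ x ≡ y → flip π ⟨$⟩ʳ y ≡ x
    back ≡.refl = Perm.inverseˡ π

  T₃-inverse : ∀ {π} → T₃ π → T₃ (Group._⁻¹ (A n) π)
  T₃-inverse {π , _} (i , j , k , i<j , j<k , inj₁ c) =
    i , j , k , i<j , j<k , inj₂ (isCycle-flip {i} {j} {k} π c)
  T₃-inverse {π , _} (i , j , k , i<j , j<k , inj₂ c) =
    i , j , k , i<j , j<k , inj₁ (isCycle-flip {i} {k} {j} π c)

CAG : ℕ → Graph 0ℓ 0ℓ 0ℓ
CAG n = Cay (A n) T₃ T₃?
  (λ {π} {ρ} → T₃-resp {n} {π} {ρ}) ε∉T₃ (λ {π} → T₃-inverse {n} {π})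

module Spectra {c ℓ₁ ℓ₂} (K : OrderedField c ℓ₁ ℓ₂) where
  open OrderedField K

  Matrix : ℕ → Set c
  Matrix N = Fin N → Fin N → Carrier

  adjacencyMatrix : ∀ {v ℓ e} (G : Graph v ℓ e) {N} → Graph.Labelling G N → Matrix N
  adjacencyMatrix G lab i j =
    if does (Inverse.to lab i ∼? Inverse.to lab j) then 1# else 0#
    where open Graph G

  module _ {N : ℕ} where

    linearCombination : ∀ {m} → Vector Carrier m → (Fin m → Vector Carrier N) → Vector Carrier N
    linearCombination a b x = sum λ i → a i * b i x

    record HasDimension {p} (U : Pred (Vector Carrier N) p) (m : ℕ) : Set (c ⊔ ℓ₁ ⊔ p) where
      field
        basis       : Fin m → Vector Carrier N
        basis∈U     : ∀ i → U (basis i)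
        independent : ∀ a → (∀ x → linearCombination a basis x ≈ 0#) → ∀ i → a i ≈ 0#
        spanning    : ∀ u → U u → ∃[ a ] (∀ x → u x ≈ linearCombination a basis x)

    Eigenspace : Matrix N → Carrier → Pred (Vector Carrier N) ℓ₁
    Eigenspace M μ u = ∀ i → sum (λ j → M i j * u j) ≈ μ * u i

    multiplicity : Carrier → List Carrier → ℕ
    multiplicity μ λs = length (filter (_≟ μ) λs)

    -- Every μ occurs dim ker (M - μ) times, so not at all unless it is an
    -- eigenvalue.  For a symmetric M this is also the multiplicity of μ as
    -- a root of the characteristic polynomial.
    record IsSpectrum (M : Matrix N) (λs : List Carrier) : Set (c ⊔ ℓ₁ ⊔ ℓ₂) where
      field
        length≡N       : length λs ≡ N
        decreasing     : Linked (λ x y → y ≤ x) λs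
        multiplicities : ∀ μ → HasDimension (Eigenspace M μ) (multiplicity μ λs)

-- For a set S of m positions let R_S average functions on A_n over the cosets
-- of the alternating group of S.  By induction on m, the sum of 1 − c over the
-- 3-cycles c within S is at least m(m − 2)(1 − R_S) as a quadratic form:
-- summing the claim for S ∖ {k} over k reduces it to
--   Σ_k R_{S∖k} ≤ m/(m − 1) (1 − R_S) + m R_S,
-- and Σ_k R_{S∖k} − m R_S is m/(m − 1) times an orthogonal projection because
-- the alternating group of S is 2-transitive.  For S = {1,…,n} the spectral gap
-- is thus at least n(n − 2).  A function of the image of one point with zero sum
-- attains it, and 2C(n,3) − n(n − 2) = n(n − 2)(n − 4)/3.
module Submission where

open import Defs
open import Algebra.Bundles using (CommutativeRing; Group; RawRing)
import Algebra.Properties.AbelianGroup as AbelianGroupProperties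
import Algebra.Properties.CommutativeMonoid.Sum as CommutativeMonoidSum
import Algebra.Properties.Ring as RingProperties
import Algebra.Properties.Semiring.Mult as SemiringMult
import Algebra.Properties.Semiring.Mult.TCOptimised as SemiringMultTCOptimised
import Algebra.Properties.Semiring.Sum as SemiringSum
import Algebra.Solver.Ring as RingSolver
open import Algebra.Solver.Ring.AlmostCommutativeRing using (fromCommutativeRing; _-Raw-AlmostCommutative⟶_)
open import Data.Bool.Base using (Bool; true; false; not; _xor_; if_then_else_)
open import Data.Bool.Properties using (xor-∧-commutativeRing; not-involutive; not-¬; not-distribˡ-xor; not-distribʳ-xor)
open import Data.Fin.Base using (Fin; zero; suc; punchIn; punchOut)
open import Data.Fin.Permutation as Perm using (Permutation′; _⟨$⟩ʳ_; _⟨$⟩ˡ_; permutation)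
import Data.Fin.Permutation.Components as PC
open import Data.Fin.Permutation.Transposition.List using (TranspositionList; eval)
open import Data.Fin.Properties using (<-cmp; <⇒≢; <-trans; any?; all?; punchIn-injective; punchIn-punchOut; punchInᵢ≢i) renaming (_≟_ to _≟ᶠ_; _<?_ to _<ᶠ?_)
open import Data.Integer.Base as ℤ using (ℤ; +_; -[1+_])
import Data.Integer.Properties as ℤ
open import Data.List.Base using (List; []; _∷_; length; filter)
open import Data.List.Membership.Propositional using (_∈_)
open import Data.List.Membership.Propositional.Properties using (∈-filter⁺; ∈-filter⁻)
open import Data.List.Properties using (filter-accept)
open import Data.List.Relation.Binary.Prefix.Heterogeneous using (Prefix; []; _∷_)
open import Data.List.Relation.Unary.All as All using (All; []; _∷_)
open import Data.List.Relation.Unary.Any using (here; there)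
open import Data.List.Relation.Unary.Linked using (Linked; _∷_)
open import Data.List.Relation.Unary.Linked.Properties using (Linked⇒All)
open import Data.Maybe.Base using (Maybe; just; nothing)
open import Data.Nat.Base as ℕ using (ℕ; zero; suc; s≤s)
open import Data.Nat.Combinatorics using (_C_; nC1≡n; nCk+nC[k+1]≡[n+1]C[k+1])
open import Data.Nat.Divisibility using (divides; divides-refl)
import Data.Nat.Properties as ℕ
open import Data.Nat.Solver using (module +-*-Solver)
open import Data.Product.Base using (_×_; _,_; proj₁; proj₂; ∃-syntax; Σ-syntax; uncurry)
open import Data.Sum.Base using (_⊎_; inj₁; inj₂)
open import Data.Vec.Functional using (Vector)
open import Function.Base using (_∘_; id)
open import Function.Bundles using (Inverse)
open import Relation.Binary.Bundles using (DecTotalOrder)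
open import Relation.Binary.Definitions using (tri<; tri≈; tri>)
open import Relation.Binary.PropositionalEquality as ≡ using (_≡_; _≢_; _≗_)
import Relation.Binary.Reasoning.Setoid as SetoidReasoning
open import Relation.Nullary using (¬_; Dec; does; yes; no; contradiction; _×-dec_; _→-dec_; ¬?)
open import Relation.Nullary.Decidable using (dec-true; dec-false)
open import Relation.Unary using (Pred)

-- Let s be the size of S, R the average over S, and P the sum of the averages over the sets S minus
-- one point. The product of the averages that omit two different points counts permutations with
-- two prescribed images, and 2-transitivity evaluates this count. The outcome is (s - 1)P² = sP +
-- (s - 2)s²R. With PR = sR it says that (s - 1)/s times P - sR is idempotent, which is where the
-- constant s/(s - 1) comes from. The scalars form an arbitrary ordered field, so positivity is
-- extracted from sums of squares: the complementary projection sends f to some g with ⟨g , g⟩ a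
-- positive multiple of ⟨f , g⟩. Denominators are avoided throughout: an average is replaced by a
-- 0/1 kernel, the order of the group by a row sum, and the form of 1 - R by a sum of squared
-- differences. The induction starts at three points, because the alternating group of two points is
-- trivial and the step to s points divides by s - 3. As zero-sum functions of the image of one
-- point attain the final bound, no step of the induction loses anything on them.

-- Ordered-field arithmetic, finite sums and indicators.

module FieldProperties {c ℓ₁ ℓ₂} (K : OrderedField c ℓ₁ ℓ₂) where
  open OrderedField K public hiding (zero)
  open SemiringSum semiring public
    using (*-distribˡ-sum; *-distribʳ-sum; ∑-distrib-+; ∑-comm; sum-remove; sum-permute;
           sum-cong-≋; sum-replicate-zero)
  open SetoidReasoning setoid

  private
    module Mult = SemiringMult semiring
    module Mult′ = SemiringMultTCOptimised semiring
    module Ring = RingProperties ring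
    module +-Group = AbelianGroupProperties +-abelianGroup
    open Mult′ using () renaming (_×_ to _×′_)

    -- Integer coefficients let the ring solver work with subtraction in any ordered field. With the
    -- optimised multiple, `ι (+ 1)` is `1#` itself and not `1# + 0#`, so `con (+ 1)` matches a
    -- literal `1#` in a goal.
    ι : ℤ → Carrier
    ι (+ m)      = m ×′ 1#
    ι (-[1+ m ]) = - (suc m ×′ 1#)

    ι-⊖ : ∀ m n → ι (m ℤ.⊖ n) ≈ m ×′ 1# - n ×′ 1#
    ι-⊖ m zero = begin
      m ×′ 1#        ≈⟨ +-identityʳ _ ⟨
      m ×′ 1# + 0#   ≈⟨ +-congˡ +-Group.ε⁻¹≈ε ⟨
      m ×′ 1# - 0#   ∎
    ι-⊖ zero (suc n) = sym (+-identityˡ _)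
    ι-⊖ (suc m) (suc n) = begin
      ι (suc m ℤ.⊖ suc n)                    ≡⟨ ≡.cong ι (ℤ.[1+m]⊖[1+n]≡m⊖n m n) ⟩
      ι (m ℤ.⊖ n)                            ≈⟨ ι-⊖ m n ⟩
      m ×′ 1# - n ×′ 1#                      ≈⟨ +-congʳ (+-Group.xyx⁻¹≈y 1# (m ×′ 1#)) ⟨
      (1# + m ×′ 1#) - 1# - n ×′ 1#          ≈⟨ +-assoc _ _ _ ⟩
      (1# + m ×′ 1#) + (- 1# - n ×′ 1#)      ≈⟨ +-congˡ (+-Group.⁻¹-∙-comm 1# (n ×′ 1#)) ⟩
      (1# + m ×′ 1#) - (1# + n ×′ 1#)        ≈⟨ +-cong (Mult′.1+× m 1#) (-‿cong (Mult′.1+× n 1#)) ⟨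
      suc m ×′ 1# - suc n ×′ 1#              ∎

    ι-+ : ∀ x y → ι (x ℤ.+ y) ≈ ι x + ι y
    ι-+ (+ m)      (+ n)      = Mult′.×-homo-+ 1# m n
    ι-+ (+ m)      (-[1+ n ]) = ι-⊖ m (suc n)
    ι-+ (-[1+ m ]) (+ n)      = trans (ι-⊖ n (suc m)) (+-comm _ _)
    ι-+ (-[1+ m ]) (-[1+ n ]) = begin
      - (suc (suc (m ℕ.+ n)) ×′ 1#)          ≡⟨ ≡.cong (λ k → - (suc k ×′ 1#)) (ℕ.+-suc m n) ⟨
      - ((suc m ℕ.+ suc n) ×′ 1#)            ≈⟨ -‿cong (Mult′.×-homo-+ 1# (suc m) (suc n)) ⟩
      - (suc m ×′ 1# + suc n ×′ 1#)          ≈⟨ +-Group.⁻¹-∙-comm _ _ ⟨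
      - (suc m ×′ 1#) - suc n ×′ 1#          ∎

    ι-neg : ∀ x → ι (ℤ.- x) ≈ - ι x
    ι-neg (+ zero)   = sym +-Group.ε⁻¹≈ε
    ι-neg (+ suc m)  = refl
    ι-neg (-[1+ m ]) = sym (+-Group.⁻¹-involutive _)

    ι-* : ∀ x y → ι (x ℤ.* y) ≈ ι x * ι y
    ι-* (+ m) (+ n) = trans (reflexive (≡.cong ι (≡.sym (ℤ.pos-* m n)))) (Mult′.×1-homo-* m n)
    ι-* (+ m) (-[1+ n ]) = begin
      ι (+ m ℤ.* -[1+ n ])                   ≡⟨ ≡.cong ι (ℤ.neg-distribʳ-* (+ m) (+ suc n)) ⟨
      ι (ℤ.- (+ m ℤ.* + suc n))              ≈⟨ ι-neg (+ m ℤ.* + suc n) ⟩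
      - ι (+ m ℤ.* + suc n)                  ≈⟨ -‿cong (ι-* (+ m) (+ suc n)) ⟩
      - (m ×′ 1# * (suc n ×′ 1#))            ≈⟨ Ring.-‿distribʳ-* _ _ ⟩
      m ×′ 1# * - (suc n ×′ 1#)              ∎
    ι-* (-[1+ m ]) (+ n) = begin
      ι (-[1+ m ] ℤ.* + n)                   ≡⟨ ≡.cong ι (ℤ.neg-distribˡ-* (+ suc m) (+ n)) ⟨
      ι (ℤ.- (+ suc m ℤ.* + n))              ≈⟨ ι-neg (+ suc m ℤ.* + n) ⟩
      - ι (+ suc m ℤ.* + n)                  ≈⟨ -‿cong (ι-* (+ suc m) (+ n)) ⟩
      - (suc m ×′ 1# * (n ×′ 1#))            ≈⟨ Ring.-‿distribˡ-* _ _ ⟩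
      - (suc m ×′ 1#) * (n ×′ 1#)            ∎
    ι-* (-[1+ m ]) (-[1+ n ]) = begin
      ι (-[1+ m ] ℤ.* -[1+ n ])              ≈⟨ Mult′.×1-homo-* (suc m) (suc n) ⟩
      suc m ×′ 1# * (suc n ×′ 1#)            ≈⟨ +-Group.⁻¹-involutive _ ⟨
      - - (suc m ×′ 1# * (suc n ×′ 1#))      ≈⟨ -‿cong (Ring.-‿distribʳ-* _ _) ⟩
      - (suc m ×′ 1# * - (suc n ×′ 1#))      ≈⟨ Ring.-‿distribˡ-* _ _ ⟩
      - (suc m ×′ 1#) * - (suc n ×′ 1#)      ∎

    ℤ-rawRing : RawRing _ _
    ℤ-rawRing = record
      { Carrier = ℤ ; _≈_ = _≡_ ; _+_ = ℤ._+_ ; _*_ = ℤ._*_ ; -_ = ℤ.-_ ; 0# = ℤ.0ℤ ; 1# = ℤ.1ℤ }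

    ι-homomorphism : ℤ-rawRing -Raw-AlmostCommutative⟶ fromCommutativeRing commutativeRing
    ι-homomorphism = record
      { ⟦_⟧ = ι ; +-homo = ι-+ ; *-homo = ι-* ; -‿homo = ι-neg ; 0-homo = refl ; 1-homo = refl }

    ι-≟ : ∀ x y → Maybe (ι x ≈ ι y)
    ι-≟ x y with x ℤ.≟ y
    ... | yes ≡.refl = just refl
    ... | no _       = nothing

  module Solver = RingSolver _ _ ι-homomorphism ι-≟
  open Solver using (solve; _:=_; _:+_; _:*_; _:-_; :-_; con)

  private
    decTotalOrder : DecTotalOrder c ℓ₁ ℓ₂
    decTotalOrder = record { isDecTotalOrder = isDecTotalOrder }

  open DecTotalOrder decTotalOrder public using () renaming
    (refl to ≤-refl; trans to ≤-trans; antisym to ≤-antisym; total to ≤-total;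
     reflexive to ≤-reflexive; ≤-respˡ-≈ to ≤-respˡ; ≤-respʳ-≈ to ≤-respʳ)

  +-mono-≤ : ∀ {x y u v} → x ≤ y → u ≤ v → x + u ≤ y + v
  +-mono-≤ {x} {y} {u} {v} x≤y u≤v =
    ≤-trans (+-monoʳ-≤ x u≤v) (≤-respˡ (+-comm v x) (≤-respʳ (+-comm v y) (+-monoʳ-≤ v x≤y)))

  x≤y⇒0≤y-x : ∀ {x y} → x ≤ y → 0# ≤ y - x
  x≤y⇒0≤y-x {x} {y} x≤y =
    ≤-respˡ (-‿inverseˡ x) (≤-respʳ (+-comm (- x) y) (+-monoʳ-≤ (- x) x≤y))

  0≤y-x⇒x≤y : ∀ {x y} → 0# ≤ y - x → x ≤ y
  0≤y-x⇒x≤y {x} {y} 0≤y-x =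
    ≤-respˡ (+-identityʳ x)
      (≤-respʳ (solve 2 (λ a b → a :+ (b :- a) := b) refl x y) (+-monoʳ-≤ x 0≤y-x))

  +-nonNegative : ∀ {x y} → 0# ≤ x → 0# ≤ y → 0# ≤ x + y
  +-nonNegative 0≤x 0≤y = ≤-respˡ (+-identityˡ 0#) (+-mono-≤ 0≤x 0≤y)

  *-monoˡ-≤ : ∀ {x y z} → 0# ≤ z → x ≤ y → z * x ≤ z * y
  *-monoˡ-≤ {x} {y} {z} 0≤z x≤y = 0≤y-x⇒x≤y
    (≤-respʳ (solve 3 (λ a b d → d :* (b :- a) := d :* b :- d :* a) refl x y z)
      (*-nonNegative 0≤z (x≤y⇒0≤y-x x≤y)))

  x≤0⇒0≤-x : ∀ {x} → x ≤ 0# → 0# ≤ - x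
  x≤0⇒0≤-x x≤0 = ≤-respʳ (+-identityˡ _) (x≤y⇒0≤y-x x≤0)

  0≤x² : ∀ x → 0# ≤ x * x
  0≤x² x with ≤-total 0# x
  ... | inj₁ 0≤x = *-nonNegative 0≤x 0≤x
  ... | inj₂ x≤0 = ≤-respʳ (solve 1 (λ a → (:- a) :* (:- a) := a :* a) refl x)
    (*-nonNegative (x≤0⇒0≤-x x≤0) (x≤0⇒0≤-x x≤0))

  0≤1 : 0# ≤ 1#
  0≤1 = ≤-respʳ (*-identityˡ 1#) (0≤x² 1#)

  *-cancelˡ-≈0 : ∀ {x y} → ¬ (x ≈ 0#) → x * y ≈ 0# → y ≈ 0#
  *-cancelˡ-≈0 {x} {y} x≉0 xy≈0 = begin
    y               ≈⟨ *-identityˡ y ⟨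
    1# * y          ≈⟨ *-congʳ (⁻¹-inverse x x≉0) ⟨
    x * x ⁻¹ * y    ≈⟨ solve 3 (λ a b d → a :* b :* d := b :* (a :* d)) refl x (x ⁻¹) y ⟩
    x ⁻¹ * (x * y)  ≈⟨ *-congˡ xy≈0 ⟩
    x ⁻¹ * 0#       ≈⟨ zeroʳ _ ⟩
    0#              ∎

  x-y≈0⇒x≈y : ∀ {x y} → x - y ≈ 0# → x ≈ y
  x-y≈0⇒x≈y {x} {y} = +-Group.x∙y⁻¹≈ε⇒x≈y x y

  *-cancelˡ : ∀ {x y z} → ¬ (x ≈ 0#) → x * y ≈ x * z → y ≈ z
  *-cancelˡ {x} {y} {z} x≉0 xy≈xz = x-y≈0⇒x≈y (*-cancelˡ-≈0 x≉0 (begin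
    x * (y - z)    ≈⟨ solve 3 (λ a b d → a :* (b :- d) := a :* b :- a :* d) refl x y z ⟩
    x * y - x * z  ≈⟨ +-congʳ xy≈xz ⟩
    x * z - x * z  ≈⟨ -‿inverseʳ _ ⟩
    0#             ∎))

  *-cancelˡ-0≤ : ∀ {x y} → 0# ≤ x → ¬ (x ≈ 0#) → 0# ≤ x * y → 0# ≤ y
  *-cancelˡ-0≤ {x} {y} 0≤x x≉0 0≤xy with ≤-total 0# y
  ... | inj₁ 0≤y = 0≤y
  ... | inj₂ y≤0 = ≤-reflexive (sym (*-cancelˡ-≈0 x≉0
          (≤-antisym (≤-respʳ (zeroʳ x) (*-monoˡ-≤ 0≤x y≤0)) 0≤xy)))

  *-cancelˡ-≤ : ∀ {x y z} → 0# ≤ x → ¬ (x ≈ 0#) → x * y ≤ x * z → y ≤ z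
  *-cancelˡ-≤ {x} {y} {z} 0≤x x≉0 xy≤xz = 0≤y-x⇒x≤y (*-cancelˡ-0≤ 0≤x x≉0
    (≤-respʳ (solve 3 (λ a b d → a :* d :- a :* b := a :* (d :- b)) refl x y z) (x≤y⇒0≤y-x xy≤xz)))

  x²≈0⇒x≈0 : ∀ {x} → x * x ≈ 0# → x ≈ 0#
  x²≈0⇒x≈0 {x} x²≈0 with x ≟ 0#
  ... | yes x≈0 = x≈0
  ... | no  x≉0 = *-cancelˡ-≈0 x≉0 x²≈0

  0≤fromℕ : ∀ m → 0# ≤ fromℕ m
  0≤fromℕ zero    = ≤-refl
  0≤fromℕ (suc m) = +-nonNegative 0≤1 (0≤fromℕ m)

  1≤x⇒x≉0 : ∀ {x} → 1# ≤ x → ¬ (x ≈ 0#)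
  1≤x⇒x≉0 1≤x x≈0 = 0≉1 (≤-antisym 0≤1 (≤-respʳ x≈0 1≤x))

  -- The order forces characteristic zero, through the bound 1 ≤ m + 1.
  fromℕ≉0 : ∀ m → ¬ (fromℕ (suc m) ≈ 0#)
  fromℕ≉0 m = 1≤x⇒x≉0 (≤-respˡ (+-identityʳ 1#) (+-monoʳ-≤ 1# (0≤fromℕ m)))

  fromℕ-+ : ∀ m n → fromℕ (m ℕ.+ n) ≈ fromℕ m + fromℕ n
  fromℕ-+ = Mult.×-homo-+ 1#

  fromℕ-* : ∀ m n → fromℕ (m ℕ.* n) ≈ fromℕ m * fromℕ n
  fromℕ-* = Mult.×1-homo-*

  sum-cong : ∀ {n} {f g : Vector Carrier n} → (∀ i → f i ≈ g i) → sum f ≈ sum g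
  sum-cong = sum-cong-≋

  sum-zero : ∀ {n} {f : Vector Carrier n} → (∀ i → f i ≈ 0#) → sum f ≈ 0#
  sum-zero {n} f≈0 = trans (sum-cong f≈0) (sum-replicate-zero n)

  sum-const : ∀ n x → sum {n} (λ _ → x) ≈ fromℕ n * x
  sum-const zero    x = sym (zeroˡ x)
  sum-const (suc n) x = begin
    x + sum {n} (λ _ → x)  ≈⟨ +-congˡ (sum-const n x) ⟩
    x + fromℕ n * x        ≈⟨ solve 2 (λ a b → a :+ b :* a := (con ℤ.1ℤ :+ b) :* a) refl x (fromℕ n) ⟩
    (1# + fromℕ n) * x     ∎

  sum-neg : ∀ {n} (f : Vector Carrier n) → sum (λ i → - f i) ≈ - sum f
  sum-neg {zero}  f = sym +-Group.ε⁻¹≈ε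
  sum-neg {suc n} f = trans (+-congˡ (sum-neg (f ∘ suc))) (+-Group.⁻¹-∙-comm _ _)

  sum-distrib-- : ∀ {n} (f g : Vector Carrier n) → sum (λ i → f i - g i) ≈ sum f - sum g
  sum-distrib-- f g = trans (∑-distrib-+ f (λ i → - g i)) (+-congˡ (sum-neg g))

  sum-mono : ∀ {n} {f g : Vector Carrier n} → (∀ i → f i ≤ g i) → sum f ≤ sum g
  sum-mono {zero}  f≤g = ≤-refl
  sum-mono {suc n} f≤g = +-mono-≤ (f≤g zero) (sum-mono (f≤g ∘ suc))

  sum-nonNegative : ∀ {n} {f : Vector Carrier n} → (∀ i → 0# ≤ f i) → 0# ≤ sum f
  sum-nonNegative {n} 0≤f = ≤-respˡ (sum-replicate-zero n) (sum-mono 0≤f)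

  term≤sum : ∀ {n} {f : Vector Carrier n} → (∀ i → 0# ≤ f i) → ∀ i → f i ≤ sum f
  term≤sum {suc n} {f} 0≤f i = ≤-respˡ (+-identityʳ _)
    (≤-respʳ (sym (sum-remove {i = i} f)) (+-monoʳ-≤ (f i) (sum-nonNegative (0≤f ∘ punchIn i))))

  sum≈0⇒term≈0 : ∀ {n} {f : Vector Carrier n} → (∀ i → 0# ≤ f i) → sum f ≈ 0# → ∀ i → f i ≈ 0#
  sum≈0⇒term≈0 0≤f ∑≈0 i = ≤-antisym (≤-respʳ ∑≈0 (term≤sum 0≤f i)) (0≤f i)

  sum-single : ∀ {n} {f : Vector Carrier n} i → (∀ j → j ≢ i → f j ≈ 0#) → sum f ≈ f i
  sum-single {suc n} {f} i f≈0 = begin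
    sum f                         ≈⟨ sum-remove {i = i} f ⟩
    f i + sum (f ∘ punchIn i)     ≈⟨ +-congˡ (sum-zero (λ j → f≈0 (punchIn i j) (punchInᵢ≢i i j))) ⟩
    f i + 0#                      ≈⟨ +-identityʳ _ ⟩
    f i                           ∎

  -- This has the shape of the entries of `adjacencyMatrix`, so the kernel `α` below is that matrix
  -- by computation, and the hypothesis on the spectrum applies to it without conversion.
  ⟦_⟧ : ∀ {p} {P : Set p} → Dec P → Carrier
  ⟦ P? ⟧ = if does P? then 1# else 0#

  ⟦⟧-true : ∀ {p} {P : Set p} (P? : Dec P) → P → ⟦ P? ⟧ ≈ 1#
  ⟦⟧-true (yes _) _ = refl
  ⟦⟧-true (no ¬p) p = contradiction p ¬p

  ⟦⟧-false : ∀ {p} {P : Set p} (P? : Dec P) → ¬ P → ⟦ P? ⟧ ≈ 0#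
  ⟦⟧-false (yes p) ¬p = contradiction p ¬p
  ⟦⟧-false (no _)  _  = refl

  ⟦⟧-cong : ∀ {p q} {P : Set p} {Q : Set q} (P? : Dec P) (Q? : Dec Q) →
            (P → Q) → (Q → P) → ⟦ P? ⟧ ≈ ⟦ Q? ⟧
  ⟦⟧-cong (yes p) Q? to from = sym (⟦⟧-true Q? (to p))
  ⟦⟧-cong (no ¬p) Q? to from = sym (⟦⟧-false Q? (¬p ∘ from))

  ⟦⟧-× : ∀ {p q} {P : Set p} {Q : Set q} (P? : Dec P) (Q? : Dec Q) →
         ⟦ P? ×-dec Q? ⟧ ≈ ⟦ P? ⟧ * ⟦ Q? ⟧
  ⟦⟧-× (yes _) (yes _) = sym (*-identityˡ 1#)
  ⟦⟧-× (yes _) (no _)  = sym (zeroʳ 1#)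
  ⟦⟧-× (no _)  _       = sym (zeroˡ _)

  0≤⟦⟧ : ∀ {p} {P : Set p} (P? : Dec P) → 0# ≤ ⟦ P? ⟧
  0≤⟦⟧ (yes _) = 0≤1
  0≤⟦⟧ (no _)  = ≤-refl

  -- An equation between multiples of an indicator may be checked where it is 1.
  ⟦⟧-*-cong : ∀ {p} {P : Set p} (P? : Dec P) {x y} → (P → x ≈ y) → ⟦ P? ⟧ * x ≈ ⟦ P? ⟧ * y
  ⟦⟧-*-cong (yes p) x≈y = *-congˡ (x≈y p)
  ⟦⟧-*-cong (no _)  _   = trans (zeroˡ _) (sym (zeroˡ _))

-- Symmetric kernels and their quadratic forms.

module QuadraticForms {c ℓ₁ ℓ₂} (K : OrderedField c ℓ₁ ℓ₂) {N : ℕ} where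
  open FieldProperties K
  open Solver using (solve; _:=_; _:+_; _:*_; _:-_; con)
  open SetoidReasoning setoid

  Kernel : Set c
  Kernel = Fin N → Fin N → Carrier

  _⟨_⟩ : Kernel → Vector Carrier N → Vector Carrier N
  (W ⟨ f ⟩) i = sum λ j → W i j * f j

  dot : Vector Carrier N → Vector Carrier N → Carrier
  dot f g = sum λ i → f i * g i

  _⋆_ : Kernel → Kernel → Kernel
  (V ⋆ W) i l = sum λ j → V i j * W j l

  -- Each pair is counted in both orders, so for a symmetric kernel this is twice the Dirichlet form
  -- of a weighted graph. For the kernel `κ` below it is 2 |Alt(S)| times the form of 1 - R, and for
  -- `ακ` twice the form of the sum of all 1 - c.
  energy : Kernel → Vector Carrier N → Carrier
  energy W f = sum λ i → sum λ j → W i j * ((f i - f j) * (f i - f j))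

  Symm : Kernel → Set ℓ₁
  Symm W = ∀ i j → W i j ≈ W j i

  RowSum : Kernel → Carrier → Set ℓ₁
  RowSum W w = ∀ i → sum (W i) ≈ w

  dot-comm : ∀ f g → dot f g ≈ dot g f
  dot-comm f g = sum-cong λ i → *-comm (f i) (g i)

  dot-congʳ : ∀ f {g h} → (∀ i → g i ≈ h i) → dot f g ≈ dot f h
  dot-congʳ f g≈h = sum-cong λ i → *-congˡ (g≈h i)

  dot-zeroʳ : ∀ f {g} → (∀ i → g i ≈ 0#) → dot f g ≈ 0#
  dot-zeroʳ f g≈0 = sum-zero λ i → trans (*-congˡ (g≈0 i)) (zeroʳ (f i))

  0≤dot : ∀ f → 0# ≤ dot f f
  0≤dot f = sum-nonNegative λ i → 0≤x² (f i)

  dot≈0⇒≈0 : ∀ {f} → dot f f ≈ 0# → ∀ i → f i ≈ 0#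
  dot≈0⇒≈0 {f} ff≈0 i = x²≈0⇒x≈0 (sum≈0⇒term≈0 (λ j → 0≤x² (f j)) ff≈0 i)

  dot-scaleʳ : ∀ f x g → dot f (λ i → x * g i) ≈ x * dot f g
  dot-scaleʳ f x g = begin
    sum (λ i → f i * (x * g i))  ≈⟨ sum-cong (λ i → solve 3 (λ a b d → a :* (b :* d) := b :* (a :* d)) refl (f i) x (g i)) ⟩
    sum (λ i → x * (f i * g i))  ≈⟨ *-distribˡ-sum x (λ i → f i * g i) ⟨
    x * dot f g                  ∎

  dot-+ʳ : ∀ f g h → dot f (λ i → g i + h i) ≈ dot f g + dot f h
  dot-+ʳ f g h = trans (sum-cong λ i → distribˡ (f i) (g i) (h i))
    (∑-distrib-+ (λ i → f i * g i) (λ i → f i * h i))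

  dot--ʳ : ∀ f g h → dot f (λ i → g i - h i) ≈ dot f g - dot f h
  dot--ʳ f g h = trans
    (sum-cong λ i → solve 3 (λ a b d → a :* (b :- d) := a :* b :- a :* d) refl (f i) (g i) (h i))
    (sum-distrib-- (λ i → f i * g i) (λ i → f i * h i))

  dot-combination : ∀ f x y z g h k →
    dot f (λ i → x * g i - y * h i + z * k i) ≈ x * dot f g - y * dot f h + z * dot f k
  dot-combination f x y z g h k = begin
    dot f (λ i → x * g i - y * h i + z * k i)
      ≈⟨ dot-+ʳ f (λ i → x * g i - y * h i) (λ i → z * k i) ⟩
    dot f (λ i → x * g i - y * h i) + dot f (λ i → z * k i)
      ≈⟨ +-cong (dot--ʳ f (λ i → x * g i) (λ i → y * h i)) (dot-scaleʳ f z k) ⟩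
    dot f (λ i → x * g i) - dot f (λ i → y * h i) + z * dot f k
      ≈⟨ +-congʳ (+-cong (dot-scaleʳ f x g) (-‿cong (dot-scaleʳ f y h))) ⟩
    x * dot f g - y * dot f h + z * dot f k ∎

  ⟨⟩-dot : ∀ {W} → Symm W → ∀ f g → dot (W ⟨ f ⟩) g ≈ dot f (W ⟨ g ⟩)
  ⟨⟩-dot {W} W-sym f g = begin
    sum (λ i → sum (λ j → W i j * f j) * g i)    ≈⟨ sum-cong (λ i → *-distribʳ-sum (g i) (λ j → W i j * f j)) ⟩
    sum (λ i → sum λ j → W i j * f j * g i)      ≈⟨ ∑-comm (λ i j → W i j * f j * g i) ⟩
    sum (λ j → sum λ i → W i j * f j * g i)      ≈⟨ sum-cong (λ j → sum-cong λ i → trans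
                                                    (solve 3 (λ a b d → a :* b :* d := b :* (a :* d)) refl (W i j) (f j) (g i))
                                                    (*-congˡ (*-congʳ (W-sym i j)))) ⟩
    sum (λ j → sum λ i → f j * (W j i * g i))    ≈⟨ sum-cong (λ j → *-distribˡ-sum (f j) (λ i → W j i * g i)) ⟨
    dot f (W ⟨ g ⟩)                              ∎

  ⋆-⟨⟩ : ∀ V W f i → (V ⟨ W ⟨ f ⟩ ⟩) i ≈ ((V ⋆ W) ⟨ f ⟩) i
  ⋆-⟨⟩ V W f i = begin
    sum (λ j → V i j * sum (λ l → W j l * f l))  ≈⟨ sum-cong (λ j → *-distribˡ-sum (V i j) (λ l → W j l * f l)) ⟩
    sum (λ j → sum λ l → V i j * (W j l * f l))  ≈⟨ ∑-comm (λ j l → V i j * (W j l * f l)) ⟩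
    sum (λ l → sum λ j → V i j * (W j l * f l))  ≈⟨ sum-cong (λ l → sum-cong λ j → sym (*-assoc (V i j) (W j l) (f l))) ⟩
    sum (λ l → sum λ j → V i j * W j l * f l)    ≈⟨ sum-cong (λ l → *-distribʳ-sum (f l) (λ j → V i j * W j l)) ⟨
    ((V ⋆ W) ⟨ f ⟩) i                            ∎

  -- Expanding the square leaves one sum of squares weighted by the row sums and one weighted by the
  -- column sums; symmetry makes the two equal.
  energy-expand : ∀ {W w} → Symm W → RowSum W w → ∀ f →
    energy W f ≈ (w * dot f f - dot f (W ⟨ f ⟩)) + (w * dot f f - dot f (W ⟨ f ⟩))
  energy-expand {W} {w} W-sym W-row f = begin
    energy W f
      ≈⟨ sum-cong (λ i → sum-cong λ j → solve 3 (λ W a b →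
           W :* ((a :- b) :* (a :- b)) := (a :* a :* W :- a :* (W :* b)) :+ (b :* b :* W :- a :* (W :* b)))
           refl (W i j) (f i) (f j)) ⟩
    sum (λ i → sum λ j → (p i j - r i j) + (q i j - r i j))
      ≈⟨ sum-cong (λ i → trans (∑-distrib-+ (λ j → p i j - r i j) (λ j → q i j - r i j))
           (+-cong (sum-distrib-- (p i) (r i)) (sum-distrib-- (q i) (r i)))) ⟩
    sum (λ i → (sum (p i) - sum (r i)) + (sum (q i) - sum (r i)))
      ≈⟨ trans (∑-distrib-+ (λ i → sum (p i) - sum (r i)) (λ i → sum (q i) - sum (r i)))
           (+-cong (sum-distrib-- (λ i → sum (p i)) (λ i → sum (r i)))
                   (sum-distrib-- (λ i → sum (q i)) (λ i → sum (r i)))) ⟩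
    (∑p - ∑r) + (∑q - ∑r)
      ≈⟨ +-cong (+-cong ∑p≈ (-‿cong ∑r≈)) (+-cong ∑q≈ (-‿cong ∑r≈)) ⟩
    (w * dot f f - dot f (W ⟨ f ⟩)) + (w * dot f f - dot f (W ⟨ f ⟩)) ∎
    where
    p q r : Kernel
    p i j = f i * f i * W i j
    q i j = f j * f j * W i j
    r i j = f i * (W i j * f j)
    ∑p ∑q ∑r : Carrier
    ∑p = sum λ i → sum (p i)
    ∑q = sum λ i → sum (q i)
    ∑r = sum λ i → sum (r i)
    ∑p≈ : ∑p ≈ w * dot f f
    ∑p≈ = begin
      ∑p                               ≈⟨ sum-cong (λ i → *-distribˡ-sum (f i * f i) (W i)) ⟨
      sum (λ i → f i * f i * sum (W i)) ≈⟨ sum-cong (λ i → trans (*-congˡ (W-row i)) (*-comm _ w)) ⟩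
      sum (λ i → w * (f i * f i))      ≈⟨ *-distribˡ-sum w (λ i → f i * f i) ⟨
      w * dot f f                      ∎
    ∑q≈ : ∑q ≈ w * dot f f
    ∑q≈ = trans (∑-comm q) (trans (sum-cong λ j → sum-cong λ i → *-congˡ (W-sym i j)) ∑p≈)
    ∑r≈ : ∑r ≈ dot f (W ⟨ f ⟩)
    ∑r≈ = sum-cong λ i → sym (*-distribˡ-sum (f i) (λ j → W i j * f j))

  -- When κ² = wκ = Yκ and aY² = w(Y + bκ) with a = b + 1, both Y and κ
  -- annihilate g = wf − aYf + bκf, so that 0 ≤ ⟨g , g⟩ = w⟨f , g⟩.
  energy-comparison : ∀ {Y κ w a b} → Symm Y → Symm κ → RowSum Y w → RowSum κ w →
    0# ≤ w → ¬ (w ≈ 0#) → a ≈ 1# + b →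
    (∀ i l → (κ ⋆ κ) i l ≈ w * κ i l) →
    (∀ i l → (Y ⋆ κ) i l ≈ w * κ i l) →
    (∀ i l → a * (Y ⋆ Y) i l ≈ w * (Y i l + b * κ i l)) →
    ∀ f → b * energy κ f ≤ a * energy Y f
  energy-comparison {Y} {κ} {w} {a} {b} Y-sym κ-sym Y-row κ-row 0≤w w≉0 a≈1+b κκ Yκ YY f =
    0≤y-x⇒x≤y (≤-respʳ (sym difference) (+-nonNegative 0≤fg 0≤fg))
    where
    y r g : Vector Carrier N
    y = Y ⟨ f ⟩
    r = κ ⟨ f ⟩
    g i = w * f i - a * y i + b * r i

    κY : ∀ i l → (κ ⋆ Y) i l ≈ w * κ i l
    κY i l = begin
      (κ ⋆ Y) i l  ≈⟨ sum-cong (λ j → trans (*-cong (κ-sym i j) (Y-sym j l)) (*-comm _ _)) ⟩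
      (Y ⋆ κ) l i  ≈⟨ Yκ l i ⟩
      w * κ l i    ≈⟨ *-congˡ (κ-sym l i) ⟩
      w * κ i l    ∎

    apply-scaled : ∀ {V W u} → (∀ i l → (V ⋆ W) i l ≈ w * u i l) → ∀ i → (V ⟨ W ⟨ f ⟩ ⟩) i ≈ w * (u ⟨ f ⟩) i
    apply-scaled {V} {W} {u} VW≈ i = begin
      (V ⟨ W ⟨ f ⟩ ⟩) i              ≈⟨ ⋆-⟨⟩ V W f i ⟩
      ((V ⋆ W) ⟨ f ⟩) i              ≈⟨ sum-cong (λ l → trans (*-congʳ (VW≈ i l)) (*-assoc w (u i l) (f l))) ⟩
      sum (λ l → w * (u i l * f l))  ≈⟨ *-distribˡ-sum w (λ l → u i l * f l) ⟨
      w * (u ⟨ f ⟩) i                ∎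

    Yy : ∀ i → a * (Y ⟨ y ⟩) i ≈ w * (y i + b * r i)
    Yy i = begin
      a * (Y ⟨ y ⟩) i                           ≈⟨ *-congˡ (⋆-⟨⟩ Y Y f i) ⟩
      a * ((Y ⋆ Y) ⟨ f ⟩) i                     ≈⟨ *-distribˡ-sum a (λ l → (Y ⋆ Y) i l * f l) ⟩
      sum (λ l → a * ((Y ⋆ Y) i l * f l))       ≈⟨ sum-cong (λ l → trans (sym (*-assoc a _ (f l))) (trans (*-congʳ (YY i l)) (*-assoc w _ (f l)))) ⟩
      sum (λ l → w * ((Y i l + b * κ i l) * f l)) ≈⟨ *-distribˡ-sum w (λ l → (Y i l + b * κ i l) * f l) ⟨
      w * sum (λ l → (Y i l + b * κ i l) * f l) ≈⟨ *-congˡ (sum-cong λ l → solve 4 (λ x b z v → (x :+ b :* z) :* v := x :* v :+ b :* (z :* v)) refl (Y i l) b (κ i l) (f l)) ⟩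
      w * sum (λ l → Y i l * f l + b * (κ i l * f l)) ≈⟨ *-congˡ (∑-distrib-+ (λ l → Y i l * f l) (λ l → b * (κ i l * f l))) ⟩
      w * (y i + sum (λ l → b * (κ i l * f l))) ≈⟨ *-congˡ (+-congˡ (*-distribˡ-sum b (λ l → κ i l * f l))) ⟨
      w * (y i + b * r i)                       ∎

    Yg≈0 : ∀ i → (Y ⟨ g ⟩) i ≈ 0#
    Yg≈0 i = begin
      (Y ⟨ g ⟩) i
        ≈⟨ dot-combination (Y i) w a b f y r ⟩
      w * y i - a * (Y ⟨ y ⟩) i + b * (Y ⟨ r ⟩) i
        ≈⟨ +-cong (+-congˡ (-‿cong (Yy i))) (*-congˡ (apply-scaled Yκ i)) ⟩
      w * y i - w * (y i + b * r i) + b * (w * r i)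
        ≈⟨ solve 4 (λ w y b r → w :* y :- w :* (y :+ b :* r) :+ b :* (w :* r) := con (+ 0)) refl w (y i) b (r i) ⟩
      0# ∎

    κg≈0 : ∀ i → (κ ⟨ g ⟩) i ≈ 0#
    κg≈0 i = begin
      (κ ⟨ g ⟩) i
        ≈⟨ dot-combination (κ i) w a b f y r ⟩
      w * r i - a * (κ ⟨ y ⟩) i + b * (κ ⟨ r ⟩) i
        ≈⟨ +-cong (+-congˡ (-‿cong (*-cong a≈1+b (apply-scaled κY i)))) (*-congˡ (apply-scaled κκ i)) ⟩
      w * r i - (1# + b) * (w * r i) + b * (w * r i)
        ≈⟨ solve 3 (λ w b r → w :* r :- (con (+ 1) :+ b) :* (w :* r) :+ b :* (w :* r) := con (+ 0)) refl w b (r i) ⟩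
      0# ∎

    gg≈wfg : dot g g ≈ w * dot f g
    gg≈wfg = begin
      dot g g
        ≈⟨ dot-combination g w a b f y r ⟩
      w * dot g f - a * dot g y + b * dot g r
        ≈⟨ +-cong (+-congˡ (-‿cong (*-congˡ (annihilate Y-sym Yg≈0)))) (*-congˡ (annihilate κ-sym κg≈0)) ⟩
      w * dot g f - a * 0# + b * 0#
        ≈⟨ +-congʳ (+-congʳ (*-congˡ (dot-comm g f))) ⟩
      w * dot f g - a * 0# + b * 0#
        ≈⟨ solve 3 (λ x a b → x :- a :* con (+ 0) :+ b :* con (+ 0) := x) refl (w * dot f g) a b ⟩
      w * dot f g ∎
      where
      annihilate : ∀ {W} → Symm W → (∀ i → (W ⟨ g ⟩) i ≈ 0#) → dot g (W ⟨ f ⟩) ≈ 0#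
      annihilate {W} W-sym Wg≈0 =
        trans (dot-comm g (W ⟨ f ⟩)) (trans (⟨⟩-dot W-sym f g) (dot-zeroʳ f Wg≈0))

    0≤fg : 0# ≤ dot f g
    0≤fg = *-cancelˡ-0≤ 0≤w w≉0 (≤-respʳ gg≈wfg (0≤dot g))

    difference : a * energy Y f - b * energy κ f ≈ dot f g + dot f g
    difference = begin
      a * energy Y f - b * energy κ f
        ≈⟨ +-cong (*-congˡ (energy-expand Y-sym Y-row f)) (-‿cong (*-congˡ (energy-expand κ-sym κ-row f))) ⟩
      a * (u - s + (u - s)) - b * (u - t + (u - t))
        ≈⟨ solve 5 (λ a b u s t → a :* (u :- s :+ (u :- s)) :- b :* (u :- t :+ (u :- t)) :=
                     (a :* (u :- s) :- b :* (u :- t)) :+ (a :* (u :- s) :- b :* (u :- t))) refl a b u s t ⟩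
      (a * (u - s) - b * (u - t)) + (a * (u - s) - b * (u - t))
        ≈⟨ +-cong half half ⟩
      dot f g + dot f g ∎
      where
      u s t : Carrier
      u = w * dot f f
      s = dot f y
      t = dot f r
      half : a * (u - s) - b * (u - t) ≈ dot f g
      half = begin
        a * (u - s) - b * (u - t)
          ≈⟨ solve 5 (λ a b u s t → a :* (u :- s) :- b :* (u :- t) := (a :- b) :* u :- a :* s :+ b :* t) refl a b u s t ⟩
        (a - b) * u - a * s + b * t
          ≈⟨ +-congʳ (+-congʳ (trans (*-congʳ (trans (+-congʳ a≈1+b)
               (solve 1 (λ b → con (+ 1) :+ b :- b := con (+ 1)) refl b))) (*-identityˡ u))) ⟩
        u - a * s + b * t
          ≈⟨ dot-combination f w a b f y r ⟨
        dot f g ∎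

-- Numbered families of permutations with 3-cycle adjacency.

Distinct₃ : ∀ {m} → Fin m → Fin m → Fin m → Set
Distinct₃ a b d = a ≢ b × b ≢ d × d ≢ a

third : ∀ {m} {a b : Fin (3 ℕ.+ m)} → a ≢ b → ∃[ d ] Distinct₃ a b d
third {a = a} {b} a≢b = punchIn a (punchIn b′ zero) , a≢b ,
  (λ b≡d → punchInᵢ≢i b′ zero (≡.sym (punchIn-injective a b′ _ (≡.trans (punchIn-punchOut a≢b) b≡d)))) ,
  punchInᵢ≢i a _
  where b′ = punchOut a≢b

Injective : ∀ {m n} → (Fin m → Fin n) → Set
Injective e = ∀ {k l} → e k ≡ e l → k ≡ l

-- j is i precomposed with the cycle (p , q , r).
record CycleStep {n} (i j : Fin n → Fin n) (p q r : Fin n) : Set where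
  field
    distinct : Distinct₃ p q r
    p↦q      : j p ≡ i q
    q↦r      : j q ≡ i r
    r↦p      : j r ≡ i p
    fixed    : ∀ x → x ≢ p → x ≢ q → x ≢ r → j x ≡ i x

-- Right multiplication by a group element. Products are read left to right, so it acts on the
-- values of a permutation; `index` is the permutation that it induces on the numbering.
record Translation {n N} (val : Fin N → Fin n → Fin n) : Set where
  field
    index  : Permutation′ N
    value  : Fin n → Fin n
    value-injective : Injective value
    act    : ∀ i x → val (index ⟨$⟩ʳ i) x ≡ value (val i x)

open Translation

-- The interface between the group and the spectral argument. Edges multiply on the left and so
-- permute positions, while translations permute values; hence the two commute. `translate` says
-- that translations act transitively, and `rotate` that every 3-cycle of values is one of them.
-- Evenness enters through `cycle⇒∼`: two different members that agree off three points differ by a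
-- 3-cycle and not by a transposition.
record PermutationFamily (n N : ℕ) : Set₁ where
  field
    val            : Fin N → Fin n → Fin n
    val-injective  : ∀ i → Injective (val i)
    val-surjective : ∀ i y → ∃[ x ] val i x ≡ y
    val-extensional : ∀ {i j} → (∀ x → val i x ≡ val j x) → i ≡ j
    translate : ∀ i j → Σ[ t ∈ Translation val ] (∀ x → val j x ≡ value t (val i x))
    rotate    : ∀ {a b d} → Distinct₃ a b d → Σ[ t ∈ Translation val ] CycleStep (λ x → x) (value t) a b d
    _∼_       : Fin N → Fin N → Set
    _∼?_      : ∀ i j → Dec (i ∼ j)
    ∼-sym     : ∀ {i j} → i ∼ j → j ∼ i
    ∼⇒cycle   : ∀ {i j} → i ∼ j → ∃[ p ] ∃[ q ] ∃[ r ] CycleStep (val i) (val j) p q r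
    cycle⇒∼   : ∀ {i j p q r} → Distinct₃ p q r → i ≢ j →
                (∀ x → x ≢ p → x ≢ q → x ≢ r → val i x ≡ val j x) → i ∼ j

-- Cosets of the alternating group of a set of positions.

module Agreement {n N : ℕ} (F : PermutationFamily n N) where
  open PermutationFamily F

  _∉im_ : ∀ {m} → Fin n → (Fin m → Fin n) → Set
  x ∉im e = ∀ k → e k ≢ x

  -- Equivalently j is i precomposed with a permutation supported on the image of e.
  Agree : ∀ {m} → (Fin m → Fin n) → Fin N → Fin N → Set
  Agree e i j = ∀ x → x ∉im e → val i x ≡ val j x

  agree? : ∀ {m} (e : Fin m → Fin n) i j → Dec (Agree e i j)
  agree? e i j = all? λ x → (all? λ k → ¬? (e k ≟ᶠ x)) →-dec (val i x ≟ᶠ val j x)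

  agree-refl : ∀ {m} {e : Fin m → Fin n} {i} → Agree e i i
  agree-refl x _ = ≡.refl

  agree-sym : ∀ {m} {e : Fin m → Fin n} {i j} → Agree e i j → Agree e j i
  agree-sym i~j x x∉ = ≡.sym (i~j x x∉)

  agree-trans : ∀ {m} {e : Fin m → Fin n} {i j l} → Agree e i j → Agree e j l → Agree e i l
  agree-trans i~j j~l x x∉ = ≡.trans (i~j x x∉) (j~l x x∉)

  -- Two injections that agree off a set take the same values on it.
  agree-image : ∀ {m} {e : Fin m → Fin n} {i j} → Agree e i j →
                ∀ k → ∃[ l ] val j (e k) ≡ val i (e l)
  agree-image {e = e} {i} {j} i~j k with val-surjective i (val j (e k))
  ... | x , ix≡jk with any? (λ l → e l ≟ᶠ x)
  ...   | yes (l , el≡x) = l , ≡.trans (≡.sym ix≡jk) (≡.cong (val i) (≡.sym el≡x))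
  -- Off the image `i` and `j` agree, so injectivity of `j` forces x = e k. This already yields the
  -- equation with l = k, and the impossible case needs no separate refutation.
  ...   | no  x∉         = k , ≡.trans (≡.sym ix≡jk) (≡.cong (val i)
            (val-injective j (≡.trans (≡.sym (i~j x (λ l el≡x → x∉ (l , el≡x)))) ix≡jk)))

  infixl 6 _∖_

  _∖_ : ∀ {m} → (Fin (suc m) → Fin n) → Fin (suc m) → Fin m → Fin n
  (e ∖ k) h = e (punchIn k h)

  ∖-injective : ∀ {m} {e : Fin (suc m) → Fin n} {k} → Injective e → Injective (e ∖ k)
  ∖-injective {k = k} e-inj = punchIn-injective k _ _ ∘ e-inj

  agree-∖⁻ : ∀ {m} {e : Fin (suc m) → Fin n} {k i j} → Injective e →
             Agree (e ∖ k) i j → Agree e i j × val i (e k) ≡ val j (e k)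
  agree-∖⁻ {k = k} e-inj i~j =
    (λ x x∉ → i~j x (λ h → x∉ (punchIn k h))) , i~j _ (λ h → punchInᵢ≢i k h ∘ e-inj)

  agree-∖⁺ : ∀ {m} {e : Fin (suc m) → Fin n} {k i j} →
             Agree e i j → val i (e k) ≡ val j (e k) → Agree (e ∖ k) i j
  agree-∖⁺ {e = e} {k} {i} {j} i~j ik≡jk x x∉ with e k ≟ᶠ x
  ... | yes ≡.refl = ik≡jk
  ... | no  ek≢x   = i~j x λ h eh≡x → case h eh≡x (k ≟ᶠ h)
    where
    case : ∀ h → e h ≡ x → ¬ Dec (k ≡ h)
    case h eh≡x (yes ≡.refl) = ek≢x eh≡x
    case h eh≡x (no k≢h)     = x∉ (punchOut k≢h) (≡.trans (≡.cong e (punchIn-punchOut k≢h)) eh≡x)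

  translate-agree : ∀ {m} {e : Fin m → Fin n} (t : Translation val) {i i′ j} →
    (∀ x → val i′ x ≡ value t (val i x)) → Agree e i j → Agree e i′ (index t ⟨$⟩ʳ j)
  translate-agree t i′≡ i~j x x∉ =
    ≡.trans (i′≡ x) (≡.trans (≡.cong (value t) (i~j x x∉)) (≡.sym (act t _ x)))

  translate-agree⁻ : ∀ {m} {e : Fin m → Fin n} (t : Translation val) {i i′ j} →
    (∀ x → val i′ x ≡ value t (val i x)) → Agree e i′ (index t ⟨$⟩ʳ j) → Agree e i j
  translate-agree⁻ t i′≡ i′~j x x∉ = value-injective t
    (≡.trans (≡.sym (i′≡ x)) (≡.trans (i′~j x x∉) (act t _ x)))

  module Counting {c ℓ₁ ℓ₂} (K : OrderedField c ℓ₁ ℓ₂) where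
    open FieldProperties K
    open QuadraticForms K {N}
    open SetoidReasoning setoid

    -- Dividing κ e by classSize e gives the averaging kernel of the image of e.
    κ : ∀ {m} → (Fin m → Fin n) → Kernel
    κ e i j = ⟦ agree? e i j ⟧

    classSize : ∀ {m} → (Fin m → Fin n) → Fin N → Carrier
    classSize e i = sum (κ e i)

    eq : Fin n → Fin n → Carrier
    eq x y = ⟦ x ≟ᶠ y ⟧

    eq-sym : ∀ x y → eq x y ≈ eq y x
    eq-sym x y = ⟦⟧-cong (x ≟ᶠ y) (y ≟ᶠ x) ≡.sym ≡.sym

    κ-sym : ∀ {m} (e : Fin m → Fin n) → Symm (κ e)
    κ-sym e i j = ⟦⟧-cong (agree? e i j) (agree? e j i) agree-sym agree-sym

    κ-refl : ∀ {m} (e : Fin m → Fin n) i → κ e i i ≈ 1#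
    κ-refl e i = ⟦⟧-true (agree? e i i) agree-refl

    -- Sharing a class is an equivalence relation. On the right the first factor is independent of
    -- `j`, so in every kernel product it leaves the sum over `j`, and what remains is a count
    -- inside one class.
    κ-chain : ∀ {m} (e : Fin m → Fin n) i j l → κ e i j * κ e j l ≈ κ e i l * κ e i j
    κ-chain e i j l = begin
      κ e i j * κ e j l                    ≈⟨ ⟦⟧-× (agree? e i j) (agree? e j l) ⟨
      ⟦ agree? e i j ×-dec agree? e j l ⟧  ≈⟨ ⟦⟧-cong (agree? e i j ×-dec agree? e j l) (agree? e i l ×-dec agree? e i j)
                                              (λ (i~j , j~l) → agree-trans i~j j~l , i~j)
                                              (λ (i~l , i~j) → i~j , agree-trans (agree-sym i~j) i~l) ⟩
      ⟦ agree? e i l ×-dec agree? e i j ⟧  ≈⟨ ⟦⟧-× (agree? e i l) (agree? e i j) ⟩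
      κ e i l * κ e i j                    ∎

    -- Omitting a point cuts each coset into cosets of the stabiliser of that point.
    κ-∖ : ∀ {m} {e : Fin (suc m) → Fin n} → Injective e → ∀ k i j →
          κ (e ∖ k) i j ≈ κ e i j * eq (val j (e k)) (val i (e k))
    κ-∖ {e = e} e-inj k i j = trans
      (⟦⟧-cong (agree? (e ∖ k) i j) (agree? e i j ×-dec (val j (e k) ≟ᶠ val i (e k)))
        (λ i~j → let i~j′ , ik≡jk = agree-∖⁻ e-inj i~j in i~j′ , ≡.sym ik≡jk)
        (λ (i~j , jk≡ik) → agree-∖⁺ i~j (≡.sym jk≡ik)))
      (⟦⟧-× (agree? e i j) (val j (e k) ≟ᶠ val i (e k)))

    -- A right translation that carries `i` to `j` carries the class of `i` bijectively onto the
    -- class of `j`.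
    classSize-const : ∀ {m} (e : Fin m → Fin n) i j → classSize e i ≈ classSize e j
    classSize-const e i j with translate i j
    ... | t , j≡ti = begin
      sum (κ e i)                              ≈⟨ sum-cong (λ l → ⟦⟧-cong (agree? e i l) (agree? e j (index t ⟨$⟩ʳ l))
                                                  (translate-agree t j≡ti) (translate-agree⁻ t j≡ti)) ⟩
      sum (λ l → κ e j (index t ⟨$⟩ʳ l))       ≈⟨ sum-permute (κ e j) (index t) ⟨
      sum (κ e j)                              ∎

    1≤classSize : ∀ {m} (e : Fin m → Fin n) i → 1# ≤ classSize e i
    1≤classSize e i = ≤-respˡ (κ-refl e i) (term≤sum (λ j → 0≤⟦⟧ (agree? e i j)) i)

    count : ∀ {m} → (Fin m → Fin n) → Fin N → Fin m → Fin m → Carrier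
    count e i k l = sum λ j → κ e i j * eq (val j (e k)) (val i (e l))

    -- Transitivity of the alternating group on three or more points. Translate by the 3-cycle of
    -- values that sends the value at `e l` to the value at `e l′` and passes through a third value
    -- taken on the image. It leaves all values outside the image alone, so it permutes the class of
    -- `i` and matches the two counts.
    count-const : ∀ {m} {e : Fin (3 ℕ.+ m) → Fin n} → Injective e → ∀ i k l l′ →
                  count e i k l ≈ count e i k l′
    count-const {e = e} e-inj i k l l′ with l ≟ᶠ l′
    ... | yes ≡.refl = refl
    ... | no l≢l′ with third l≢l′
    ...   | w , _ , l′≢w , w≢l with rotate {val i (e l)} {val i (e l′)} {val i (e w)}
              (l≢l′ ∘ e-inj ∘ val-injective i , l′≢w ∘ e-inj ∘ val-injective i , w≢l ∘ e-inj ∘ val-injective i)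
    ...     | t , cycle = begin
      sum (λ j → κ e i j * eq (val j (e k)) (val i (e l)))
        ≈⟨ sum-cong (λ j → *-cong
             (⟦⟧-cong (agree? e i j) (agree? e i (index t ⟨$⟩ʳ j)) (agree⁺ j) (agree⁻ j))
             (⟦⟧-cong (val j (e k) ≟ᶠ val i (e l)) (val (index t ⟨$⟩ʳ j) (e k) ≟ᶠ val i (e l′))
               (λ jk≡il → ≡.trans (act t j (e k)) (≡.trans (≡.cong (value t) jk≡il) p↦q))
               (λ tjk≡il′ → value-injective t (≡.trans (≡.sym (act t j (e k))) (≡.trans tjk≡il′ (≡.sym p↦q)))))) ⟩
      sum (λ j → κ e i (index t ⟨$⟩ʳ j) * eq (val (index t ⟨$⟩ʳ j) (e k)) (val i (e l′)))
        ≈⟨ sum-permute (λ j → κ e i j * eq (val j (e k)) (val i (e l′))) (index t) ⟨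
      sum (λ j → κ e i j * eq (val j (e k)) (val i (e l′))) ∎
      where
      open CycleStep cycle
      unmoved : ∀ x → x ∉im e → value t (val i x) ≡ val i x
      unmoved x x∉ = fixed (val i x) (off l) (off l′) (off w)
        where
        off : ∀ h → val i x ≢ val i (e h)
        off h ix≡ih = x∉ h (≡.sym (val-injective i ix≡ih))
      agree⁺ : ∀ j → Agree e i j → Agree e i (index t ⟨$⟩ʳ j)
      agree⁺ j i~j x x∉ = ≡.trans (≡.sym (unmoved x x∉)) (≡.trans (≡.cong (value t) (i~j x x∉)) (≡.sym (act t j x)))
      agree⁻ : ∀ j → Agree e i (index t ⟨$⟩ʳ j) → Agree e i j
      agree⁻ j i~tj x x∉ = value-injective t (≡.trans (unmoved x x∉) (≡.trans (i~tj x x∉) (act t j x)))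

    image-sum : ∀ {m} {e : Fin m → Fin n} → Injective e → ∀ {i j} → Agree e i j →
                ∀ k → sum (λ l → eq (val j (e k)) (val i (e l))) ≈ 1#
    image-sum {e = e} e-inj {i} {j} i~j k with agree-image i~j k
    ... | l , jk≡il = trans
      (sum-single l λ h h≢l → ⟦⟧-false (val j (e k) ≟ᶠ val i (e h))
        (λ jk≡ih → h≢l (e-inj (val-injective i (≡.trans (≡.sym jk≡ih) jk≡il)))))
      (⟦⟧-true (val j (e k) ≟ᶠ val i (e l)) jk≡il)

    -- Orbit and stabiliser in counting form: every member of the class sends `e k` to exactly one
    -- of the values of `i` on the image, and these values are hit equally often.
    count-scaled : ∀ {m} {e : Fin (3 ℕ.+ m) → Fin n} → Injective e → ∀ i k l →
                   fromℕ (3 ℕ.+ m) * count e i k l ≈ classSize e i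
    count-scaled {m} {e} e-inj i k l = begin
      fromℕ (3 ℕ.+ m) * count e i k l
        ≈⟨ sum-const (3 ℕ.+ m) (count e i k l) ⟨
      sum {3 ℕ.+ m} (λ _ → count e i k l)
        ≈⟨ sum-cong (count-const e-inj i k l) ⟩
      sum (λ h → sum λ j → κ e i j * eq (val j (e k)) (val i (e h)))
        ≈⟨ ∑-comm (λ h j → κ e i j * eq (val j (e k)) (val i (e h))) ⟩
      sum (λ j → sum λ h → κ e i j * eq (val j (e k)) (val i (e h)))
        ≈⟨ sum-cong (λ j → trans
             (sym (*-distribˡ-sum (κ e i j) (λ h → eq (val j (e k)) (val i (e h)))))
             (trans (⟦⟧-*-cong (agree? e i j) (λ i~j → image-sum e-inj i~j k)) (*-identityʳ _))) ⟩
      classSize e i ∎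

    count-diagonal : ∀ {m} {e : Fin (suc m) → Fin n} → Injective e → ∀ i k →
                     count e i k k ≈ classSize (e ∖ k) i
    count-diagonal e-inj i k = sum-cong λ j → sym (κ-∖ e-inj k i j)

    classSize-∖ : ∀ {m} {e : Fin (3 ℕ.+ m) → Fin n} → Injective e → ∀ i k →
                  fromℕ (3 ℕ.+ m) * classSize (e ∖ k) i ≈ classSize e i
    classSize-∖ e-inj i k = trans (*-congˡ (sym (count-diagonal e-inj i k))) (count-scaled e-inj i k k)

-- The spectral gap by induction on the set of positions.

module SpectralGap {c ℓ₁ ℓ₂} (K : OrderedField c ℓ₁ ℓ₂) {n N : ℕ} (F : PermutationFamily n N) (o : Fin N) where
  open FieldProperties K
  open Solver using (solve; _:=_; _:+_; _:*_; _:-_; con)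
  open QuadraticForms K {N}
  open PermutationFamily F
  open Agreement F
  open Counting K
  open SetoidReasoning setoid

  size : ∀ {m} → (Fin m → Fin n) → Carrier
  size e = classSize e o

  -- Averaging over a subgroup and then over the whole group is averaging over the group; the factor
  -- is the order of the subgroup.
  κ-∖-⋆ : ∀ {m} {e : Fin (suc m) → Fin n} → Injective e → ∀ k i l →
          (κ (e ∖ k) ⋆ κ e) i l ≈ size (e ∖ k) * κ e i l
  κ-∖-⋆ {e = e} e-inj k i l = begin
    sum (λ j → κ (e ∖ k) i j * κ e j l)
      ≈⟨ sum-cong (λ j → begin
           κ (e ∖ k) i j * κ e j l
             ≈⟨ *-congʳ (κ-∖ e-inj k i j) ⟩
           κ e i j * eq (val j (e k)) (val i (e k)) * κ e j l
             ≈⟨ solve 3 (λ x y z → x :* y :* z := x :* z :* y) refl (κ e i j) (eq (val j (e k)) (val i (e k))) (κ e j l) ⟩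
           κ e i j * κ e j l * eq (val j (e k)) (val i (e k))
             ≈⟨ *-congʳ (κ-chain e i j l) ⟩
           κ e i l * κ e i j * eq (val j (e k)) (val i (e k))
             ≈⟨ *-assoc _ _ _ ⟩
           κ e i l * (κ e i j * eq (val j (e k)) (val i (e k)))
             ≈⟨ *-congˡ (κ-∖ e-inj k i j) ⟨
           κ e i l * κ (e ∖ k) i j ∎) ⟩
    sum (λ j → κ e i l * κ (e ∖ k) i j)  ≈⟨ *-distribˡ-sum (κ e i l) (κ (e ∖ k) i) ⟨
    κ e i l * classSize (e ∖ k) i        ≈⟨ *-comm _ _ ⟩
    classSize (e ∖ k) i * κ e i l        ≈⟨ *-congʳ (classSize-const (e ∖ k) i o) ⟩
    size (e ∖ k) * κ e i l               ∎

  κ-⋆ : ∀ {m} (e : Fin m → Fin n) i l → (κ e ⋆ κ e) i l ≈ size e * κ e i l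
  κ-⋆ e i l = begin
    sum (λ j → κ e i j * κ e j l)   ≈⟨ sum-cong (λ j → κ-chain e i j l) ⟩
    sum (λ j → κ e i l * κ e i j)   ≈⟨ *-distribˡ-sum (κ e i l) (κ e i) ⟨
    κ e i l * classSize e i         ≈⟨ trans (*-comm _ _) (*-congʳ (classSize-const e i o)) ⟩
    size e * κ e i l                ∎

  -- In terms of averages this is `size e` divided by s, times the operator P, where s is the number
  -- of points of `e`.
  stabilizers : ∀ {m} → (Fin (suc m) → Fin n) → Kernel
  stabilizers e i l = sum λ k → κ (e ∖ k) i l

  stabilizers-sym : ∀ {m} (e : Fin (suc m) → Fin n) → Symm (stabilizers e)
  stabilizers-sym e i l = sum-cong λ k → κ-sym (e ∖ k) i l

  ∑-⋆ : ∀ {m} (V : Fin m → Kernel) W i l → ((λ i j → sum λ k → V k i j) ⋆ W) i l ≈ sum λ k → (V k ⋆ W) i l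
  ∑-⋆ V W i l = trans (sum-cong λ j → *-distribʳ-sum (W j l) (λ k → V k i j)) (∑-comm λ j k → V k i j * W j l)

  ⋆-∑ : ∀ {m} V (W : Fin m → Kernel) i l → (V ⋆ (λ i j → sum λ k → W k i j)) i l ≈ sum λ k → (V ⋆ W k) i l
  ⋆-∑ V W i l = trans (sum-cong λ j → *-distribˡ-sum (V i j) (λ k → W k j l)) (∑-comm λ j k → V i j * W k j l)

  energy-∑ : ∀ {m} (V : Fin m → Kernel) f → energy (λ i j → sum λ k → V k i j) f ≈ sum λ k → energy (V k) f
  energy-∑ V f = trans
    (sum-cong λ i → trans (sum-cong λ j → *-distribʳ-sum ((f i - f j) * (f i - f j)) (λ k → V k i j)) (∑-comm λ j k → V k i j * ((f i - f j) * (f i - f j))))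
    (∑-comm λ i k → sum λ j → V k i j * ((f i - f j) * (f i - f j)))

  energy-cong : ∀ {V W} f → (∀ i j → V i j ≈ W i j) → energy V f ≈ energy W f
  energy-cong f V≈W = sum-cong λ i → sum-cong λ j → *-congʳ (V≈W i j)

  energy-scale : ∀ x W f → energy (λ i j → x * W i j) f ≈ x * energy W f
  energy-scale x W f = trans
    (sum-cong λ i → trans (sum-cong λ j → *-assoc x (W i j) _) (sym (*-distribˡ-sum x (λ j → W i j * ((f i - f j) * (f i - f j))))))
    (sym (*-distribˡ-sum x (λ i → sum λ j → W i j * ((f i - f j) * (f i - f j)))))

  0≤energy : ∀ {W} → (∀ i j → 0# ≤ W i j) → ∀ f → 0# ≤ energy W f
  0≤energy 0≤W f = sum-nonNegative λ i → sum-nonNegative λ j → *-nonNegative (0≤W i j) (0≤x² (f i - f j))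

  0≤size : ∀ {m} (e : Fin m → Fin n) → 0# ≤ size e
  0≤size e = ≤-trans 0≤1 (1≤classSize e o)

  size≉0 : ∀ {m} (e : Fin m → Fin n) → ¬ (size e ≈ 0#)
  size≉0 e = 1≤x⇒x≉0 (1≤classSize e o)

  -- Each of the s stabilisers has index s. Hence `stabilizers e` and `κ e` have the same row sum,
  -- as `energy-comparison` demands.
  ∑-size-∖ : ∀ {m} {e : Fin (3 ℕ.+ m) → Fin n} → Injective e → sum (λ k → size (e ∖ k)) ≈ size e
  ∑-size-∖ {m} {e} e-inj = *-cancelˡ (fromℕ≉0 (2 ℕ.+ m)) (begin
    fromℕ (3 ℕ.+ m) * sum (λ k → size (e ∖ k))    ≈⟨ *-distribˡ-sum (fromℕ (3 ℕ.+ m)) (λ k → size (e ∖ k)) ⟩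
    sum (λ k → fromℕ (3 ℕ.+ m) * size (e ∖ k))    ≈⟨ sum-cong (classSize-∖ e-inj o) ⟩
    sum {3 ℕ.+ m} (λ _ → size e)                  ≈⟨ sum-const (3 ℕ.+ m) (size e) ⟩
    fromℕ (3 ℕ.+ m) * size e                      ∎)

  module _ {m} {e : Fin (4 ℕ.+ m) → Fin n} (e-inj : Injective e) where
    private
      a b w : Carrier
      a = fromℕ (3 ℕ.+ m)
      b = fromℕ (2 ℕ.+ m)
      w = size e

      moved : Fin N → Fin N → Fin (4 ℕ.+ m) → Fin (4 ℕ.+ m) → Carrier
      moved i l k h = eq (val l (e h)) (val i (e k))

    -- An intermediate `j` must agree with `i` at `e k` and with `l` at the other omitted point. If
    -- `l` sends that point to the value of `i` at `e k`, no injective `j` exists. Otherwise the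
    -- stabiliser of `e k`, being transitive on the `3 + m` remaining points, provides its order
    -- divided by `a`. This transitivity is why at least four points are assumed.
    stabilizer-⋆-stabilizer : ∀ k h i l →
      a * (κ (e ∖ k) ⋆ κ (e ∖ punchIn k h)) i l ≈ κ e i l * (size (e ∖ k) * (1# - moved i l k (punchIn k h)))
    stabilizer-⋆-stabilizer k h i l = begin
      a * sum (λ j → κ (e ∖ k) i j * κ (e ∖ h⁺) j l)
        ≈⟨ *-congˡ (sum-cong λ j → begin
             κ (e ∖ k) i j * κ (e ∖ h⁺) j l
               ≈⟨ *-cong (κ-∖ e-inj k i j) (κ-∖ e-inj h⁺ j l) ⟩
             κ e i j * fix j * (κ e j l * meet j)
               ≈⟨ solve 4 (λ x y z t → x :* y :* (z :* t) := x :* z :* y :* t) refl (κ e i j) (fix j) (κ e j l) (meet j) ⟩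
             κ e i j * κ e j l * fix j * meet j
               ≈⟨ *-congʳ (*-congʳ (κ-chain e i j l)) ⟩
             κ e i l * κ e i j * fix j * meet j
               ≈⟨ solve 4 (λ x y z t → x :* y :* z :* t := x :* (y :* z :* t)) refl (κ e i l) (κ e i j) (fix j) (meet j) ⟩
             κ e i l * (κ e i j * fix j * meet j)
               ≈⟨ *-congˡ (*-congʳ (κ-∖ e-inj k i j)) ⟨
             κ e i l * (κ (e ∖ k) i j * meet j) ∎) ⟩
      a * sum (λ j → κ e i l * (κ (e ∖ k) i j * meet j))
        ≈⟨ *-congˡ (*-distribˡ-sum (κ e i l) (λ j → κ (e ∖ k) i j * meet j)) ⟨
      a * (κ e i l * sum (λ j → κ (e ∖ k) i j * meet j))
        ≈⟨ solve 3 (λ x y z → x :* (y :* z) := y :* (x :* z)) refl a (κ e i l) _ ⟩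
      κ e i l * (a * sum (λ j → κ (e ∖ k) i j * meet j))
        ≈⟨ ⟦⟧-*-cong (agree? e i l) counted ⟩
      κ e i l * (size (e ∖ k) * (1# - moved i l k h⁺)) ∎
      where
      h⁺ : Fin (4 ℕ.+ m)
      h⁺ = punchIn k h
      fix meet : Fin N → Carrier
      fix j = eq (val j (e k)) (val i (e k))
      meet j = eq (val l (e h⁺)) (val j (e h⁺))
      counted : Agree e i l → a * sum (λ j → κ (e ∖ k) i j * meet j) ≈ size (e ∖ k) * (1# - moved i l k h⁺)
      counted i~l with agree-image i~l h⁺
      ... | g , lh≡ig with k ≟ᶠ g
      ...   | yes ≡.refl = begin
        a * sum (λ j → κ (e ∖ k) i j * meet j)
          ≈⟨ *-congˡ (sum-zero λ j → trans (⟦⟧-*-cong (agree? (e ∖ k) i j) λ i~j → ⟦⟧-false (val l (e h⁺) ≟ᶠ val j (e h⁺)) λ lh≡jh →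
               punchInᵢ≢i k h (e-inj (val-injective j
                 (≡.trans (≡.sym lh≡jh) (≡.trans lh≡ig (proj₂ (agree-∖⁻ e-inj i~j))))))) (zeroʳ _)) ⟩
        a * 0#
          ≈⟨ solve 2 (λ a v → a :* con (+ 0) := v :* (con (+ 1) :- con (+ 1))) refl a (size (e ∖ k)) ⟩
        size (e ∖ k) * (1# - 1#)
          ≈⟨ *-congˡ (+-congˡ (-‿cong (⟦⟧-true (val l (e h⁺) ≟ᶠ val i (e k)) lh≡ig))) ⟨
        size (e ∖ k) * (1# - moved i l k h⁺) ∎
      ...   | no k≢g = begin
        a * sum (λ j → κ (e ∖ k) i j * meet j)
          ≈⟨ *-congˡ (sum-cong λ j → *-congˡ (trans (eq-sym (val l (e h⁺)) (val j (e h⁺)))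
               (reflexive (≡.cong (eq (val j (e h⁺))) (≡.trans lh≡ig (≡.cong (val i ∘ e) (≡.sym (punchIn-punchOut k≢g)))))))) ⟩
        a * count (e ∖ k) i h (punchOut k≢g)
          ≈⟨ count-scaled (∖-injective {e = e} {k} e-inj) i h (punchOut k≢g) ⟩
        classSize (e ∖ k) i
          ≈⟨ classSize-const (e ∖ k) i o ⟩
        size (e ∖ k)
          ≈⟨ solve 1 (λ v → v := v :* (con (+ 1) :- con (+ 0))) refl (size (e ∖ k)) ⟩
        size (e ∖ k) * (1# - 0#)
          ≈⟨ *-congˡ (+-congˡ (-‿cong (⟦⟧-false (val l (e h⁺) ≟ᶠ val i (e k))
               λ lh≡ik → k≢g (e-inj (val-injective i (≡.trans (≡.sym lh≡ik) lh≡ig)))))) ⟨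
        size (e ∖ k) * (1# - moved i l k h⁺) ∎

    -- Exactly one of all points is sent by `l` to the value of `i` at `e k`. Hence of the `1 + b`
    -- points other than `k` one is lost, unless that point is `k` itself.
    ∑-unmoved : ∀ k i l → Agree e i l → sum (λ h → 1# - moved i l k (punchIn k h)) ≈ b + moved i l k k
    ∑-unmoved k i l i~l = begin
      sum (λ h → 1# - moved i l k (punchIn k h))
        ≈⟨ sum-distrib-- (λ _ → 1#) (λ h → moved i l k (punchIn k h)) ⟩
      sum {3 ℕ.+ m} (λ _ → 1#) - s
        ≈⟨ +-congʳ (trans (sum-const (3 ℕ.+ m) 1#) (*-identityʳ a)) ⟩
      1# + b - s
        ≈⟨ +-congʳ (+-congʳ (trans (sym (sum-remove {i = k} (moved i l k))) total)) ⟨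
      moved i l k k + s + b - s
        ≈⟨ solve 3 (λ x s b → x :+ s :+ b :- s := b :+ x) refl (moved i l k k) s b ⟩
      b + moved i l k k ∎
      where
      s = sum λ h → moved i l k (punchIn k h)
      total : sum (moved i l k) ≈ 1#
      total = trans (sum-cong λ h → eq-sym (val l (e h)) (val i (e k))) (image-sum e-inj (agree-sym i~l) k)

    stabilizer-⋆-stabilizers : ∀ k i l →
      a * (κ (e ∖ k) ⋆ stabilizers e) i l ≈ w * κ (e ∖ k) i l + size (e ∖ k) * (b * κ e i l)
    stabilizer-⋆-stabilizers k i l = begin
      a * (κ (e ∖ k) ⋆ stabilizers e) i l
        ≈⟨ *-congˡ (⋆-∑ (κ (e ∖ k)) (λ h → κ (e ∖ h)) i l) ⟩
      a * sum product
        ≈⟨ *-congˡ (sum-remove {i = k} product) ⟩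
      a * (product k + sum (λ h → product (punchIn k h)))
        ≈⟨ trans (distribˡ a _ _) (+-congˡ (*-distribˡ-sum a (λ h → product (punchIn k h)))) ⟩
      a * product k + sum (λ h → a * product (punchIn k h))
        ≈⟨ +-cong (*-congˡ (κ-⋆ (e ∖ k) i l)) (sum-cong λ h → stabilizer-⋆-stabilizer k h i l) ⟩
      a * (v * κₖ) + sum (λ h → κ e i l * (v * (1# - moved i l k (punchIn k h))))
        ≈⟨ +-congˡ (trans (*-congˡ (*-distribˡ-sum v (λ h → 1# - moved i l k (punchIn k h))))
             (*-distribˡ-sum (κ e i l) (λ h → v * (1# - moved i l k (punchIn k h))))) ⟨
      a * (v * κₖ) + κ e i l * (v * sum (λ h → 1# - moved i l k (punchIn k h)))
        ≈⟨ +-congˡ (⟦⟧-*-cong (agree? e i l) λ i~l → *-congˡ (∑-unmoved k i l i~l)) ⟩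
      a * (v * κₖ) + κ e i l * (v * (b + moved i l k k))
        ≈⟨ solve 6 (λ a v x y b z → a :* (v :* x) :+ y :* (v :* (b :+ z)) := a :* v :* x :+ v :* (y :* z) :+ v :* (b :* y)) refl
             a v κₖ (κ e i l) b (moved i l k k) ⟩
      a * v * κₖ + v * (κ e i l * moved i l k k) + v * (b * κ e i l)
        ≈⟨ +-congʳ (+-congˡ (*-congˡ (κ-∖ e-inj k i l))) ⟨
      -- The product of the stabiliser with itself gives `a` copies of `v * κₖ`, and the correction
      -- for `k` itself gives one more. Together they are as many copies as there are points, and by
      -- the index formula they add up to `w * κₖ`.
      a * v * κₖ + v * κₖ + v * (b * κ e i l)
        ≈⟨ +-congʳ (solve 3 (λ a v x → a :* v :* x :+ v :* x := (con (+ 1) :+ a) :* v :* x) refl a v κₖ) ⟩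
      fromℕ (4 ℕ.+ m) * v * κₖ + v * (b * κ e i l)
        ≈⟨ +-congʳ (*-congʳ (classSize-∖ e-inj o k)) ⟩
      w * κₖ + v * (b * κ e i l) ∎
      where
      v κₖ : Carrier
      v  = size (e ∖ k)
      κₖ = κ (e ∖ k) i l
      product : Vector Carrier (4 ℕ.+ m)
      product h = (κ (e ∖ k) ⋆ κ (e ∖ h)) i l

    -- After division by the group orders this is (s - 1)P² = sP + (s - 2)s²R for a set of s points.
    stabilizers-⋆-stabilizers : ∀ i l →
      a * (stabilizers e ⋆ stabilizers e) i l ≈ w * (stabilizers e i l + b * κ e i l)
    stabilizers-⋆-stabilizers i l = begin
      a * (stabilizers e ⋆ stabilizers e) i l
        ≈⟨ *-congˡ (∑-⋆ (λ k → κ (e ∖ k)) (stabilizers e) i l) ⟩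
      a * sum (λ k → (κ (e ∖ k) ⋆ stabilizers e) i l)
        ≈⟨ *-distribˡ-sum a (λ k → (κ (e ∖ k) ⋆ stabilizers e) i l) ⟩
      sum (λ k → a * (κ (e ∖ k) ⋆ stabilizers e) i l)
        ≈⟨ sum-cong (λ k → stabilizer-⋆-stabilizers k i l) ⟩
      sum (λ k → w * κ (e ∖ k) i l + size (e ∖ k) * (b * κ e i l))
        ≈⟨ ∑-distrib-+ (λ k → w * κ (e ∖ k) i l) (λ k → size (e ∖ k) * (b * κ e i l)) ⟩
      sum (λ k → w * κ (e ∖ k) i l) + sum (λ k → size (e ∖ k) * (b * κ e i l))
        ≈⟨ +-cong (*-distribˡ-sum w (λ k → κ (e ∖ k) i l)) (*-distribʳ-sum (b * κ e i l) (λ k → size (e ∖ k))) ⟨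
      w * stabilizers e i l + sum (λ k → size (e ∖ k)) * (b * κ e i l)
        ≈⟨ +-congˡ (*-congʳ (∑-size-∖ e-inj)) ⟩
      w * stabilizers e i l + w * (b * κ e i l)
        ≈⟨ distribˡ w _ _ ⟨
      w * (stabilizers e i l + b * κ e i l) ∎

    -- In averages over a set of s points: (s - 2)(1 - R) ≤ (s - 1)(1 - P/s).
    energy-stabilizers : ∀ f → b * energy (κ e) f ≤ a * sum (λ k → energy (κ (e ∖ k)) f)
    energy-stabilizers f = ≤-respʳ (*-congˡ (energy-∑ (λ k → κ (e ∖ k)) f))
      (energy-comparison (stabilizers-sym e) (κ-sym e) stabilizers-row (λ i → classSize-const e i o)
        (0≤size e) (size≉0 e) refl (κ-⋆ e) stabilizers-⋆-κ stabilizers-⋆-stabilizers f)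
      where
      stabilizers-row : RowSum (stabilizers e) w
      stabilizers-row i = begin
        sum (λ l → sum λ k → κ (e ∖ k) i l)   ≈⟨ ∑-comm (λ l k → κ (e ∖ k) i l) ⟩
        sum (λ k → classSize (e ∖ k) i)       ≈⟨ sum-cong (λ k → classSize-const (e ∖ k) i o) ⟩
        sum (λ k → size (e ∖ k))              ≈⟨ ∑-size-∖ e-inj ⟩
        w                                     ∎
      stabilizers-⋆-κ : ∀ i l → (stabilizers e ⋆ κ e) i l ≈ w * κ e i l
      stabilizers-⋆-κ i l = begin
        (stabilizers e ⋆ κ e) i l                ≈⟨ ∑-⋆ (λ k → κ (e ∖ k)) (κ e) i l ⟩
        sum (λ k → (κ (e ∖ k) ⋆ κ e) i l)        ≈⟨ sum-cong (λ k → κ-∖-⋆ e-inj k i l) ⟩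
        sum (λ k → size (e ∖ k) * κ e i l)       ≈⟨ *-distribʳ-sum (κ e i l) (λ k → size (e ∖ k)) ⟨
        sum (λ k → size (e ∖ k)) * κ e i l       ≈⟨ *-congʳ (∑-size-∖ e-inj) ⟩
        w * κ e i l                              ∎

  α : Kernel
  α i j = ⟦ i ∼? j ⟧

  -- The edges that come from 3-cycles supported on the image of `e`.
  ακ : ∀ {m} → (Fin m → Fin n) → Kernel
  ακ e i j = α i j * κ e i j

  sum-all-but-three : ∀ {m} (g : Vector Carrier (3 ℕ.+ m)) {p q r} → Distinct₃ p q r →
    g p ≈ 0# → g q ≈ 0# → g r ≈ 0# → (∀ k → k ≢ p → k ≢ q → k ≢ r → g k ≈ 1#) → sum g ≈ fromℕ m
  sum-all-but-three {m} g {p} {q} {r} (p≢q , q≢r , r≢p) gp gq gr g≈1 = begin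
    sum g
      ≈⟨ sum-cong (λ k → pointwise k (k ≟ᶠ p) (k ≟ᶠ q) (k ≟ᶠ r)) ⟩
    sum (λ k → 1# - δ p k - δ q k - δ r k)
      ≈⟨ trans (sum-distrib-- (λ k → 1# - δ p k - δ q k) (δ r)) (+-congʳ
           (trans (sum-distrib-- (λ k → 1# - δ p k) (δ q)) (+-congʳ (sum-distrib-- (λ k → 1#) (δ p))))) ⟩
    sum {3 ℕ.+ m} (λ _ → 1#) - sum (δ p) - sum (δ q) - sum (δ r)
      ≈⟨ +-cong (+-cong (+-cong (sum-const (3 ℕ.+ m) 1#) (-‿cong (∑δ p))) (-‿cong (∑δ q))) (-‿cong (∑δ r)) ⟩
    fromℕ (3 ℕ.+ m) * 1# - 1# - 1# - 1#
      ≈⟨ solve 1 (λ x → (con (+ 1) :+ (con (+ 1) :+ (con (+ 1) :+ x))) :* con (+ 1) :- con (+ 1) :- con (+ 1) :- con (+ 1) := x) refl (fromℕ m) ⟩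
    fromℕ m ∎
    where
    δ : Fin (3 ℕ.+ m) → Fin (3 ℕ.+ m) → Carrier
    δ l k = ⟦ k ≟ᶠ l ⟧
    δ-self : ∀ l → δ l l ≈ 1#
    δ-self l = ⟦⟧-true (l ≟ᶠ l) ≡.refl
    δ-apart : ∀ {k l} → k ≢ l → δ l k ≈ 0#
    δ-apart {k} {l} = ⟦⟧-false (k ≟ᶠ l)
    ∑δ : ∀ l → sum (δ l) ≈ 1#
    ∑δ l = trans (sum-single l λ k → δ-apart) (δ-self l)
    substituted : ∀ k {x y z s} → δ p k ≈ x → δ q k ≈ y → δ r k ≈ z → s ≈ 1# - x - y - z →
                  s ≈ 1# - δ p k - δ q k - δ r k
    substituted k x≈ y≈ z≈ s≈ = trans s≈
      (sym (+-cong (+-cong (+-congˡ (-‿cong x≈)) (-‿cong y≈)) (-‿cong z≈)))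
    pointwise : ∀ k → Dec (k ≡ p) → Dec (k ≡ q) → Dec (k ≡ r) → g k ≈ 1# - δ p k - δ q k - δ r k
    pointwise k (yes ≡.refl) _ _ = substituted p (δ-self p) (δ-apart p≢q) (δ-apart (r≢p ∘ ≡.sym))
      (trans gp (solve 0 (con (+ 0) := con (+ 1) :- con (+ 1) :- con (+ 0) :- con (+ 0)) refl))
    pointwise k (no k≢p) (yes ≡.refl) _ = substituted q (δ-apart k≢p) (δ-self q) (δ-apart q≢r)
      (trans gq (solve 0 (con (+ 0) := con (+ 1) :- con (+ 0) :- con (+ 1) :- con (+ 0)) refl))
    pointwise k (no k≢p) (no k≢q) (yes ≡.refl) = substituted r (δ-apart k≢p) (δ-apart k≢q) (δ-self r)
      (trans gr (solve 0 (con (+ 0) := con (+ 1) :- con (+ 0) :- con (+ 0) :- con (+ 1)) refl))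
    pointwise k (no k≢p) (no k≢q) (no k≢r) = substituted k (δ-apart k≢p) (δ-apart k≢q) (δ-apart k≢r)
      (trans (g≈1 k k≢p k≢q k≢r) (solve 0 (con (+ 1) := con (+ 1) :- con (+ 0) :- con (+ 0) :- con (+ 0)) refl))

  -- The three points of the cycle are places where `i` and `j` differ, so agreement off the image
  -- puts all three inside it; all other points of the image are fixed.
  unmoved-count : ∀ {m} {e : Fin (3 ℕ.+ m) → Fin n} → Injective e → ∀ {i j} → i ∼ j → Agree e i j →
    sum (λ k → eq (val j (e k)) (val i (e k))) ≈ fromℕ m
  unmoved-count {m} {e} e-inj {i} {j} i∼j i~j with ∼⇒cycle i∼j
  ... | p , q , r , cycle = counted (in-image p jp≢ip) (in-image q jq≢iq) (in-image r jr≢ir)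
    where
    open CycleStep cycle
    p≢q = proj₁ distinct
    q≢r = proj₁ (proj₂ distinct)
    r≢p = proj₂ (proj₂ distinct)
    jp≢ip : val j p ≢ val i p
    jp≢ip jp≡ip = p≢q (val-injective i (≡.trans (≡.sym jp≡ip) p↦q))
    jq≢iq : val j q ≢ val i q
    jq≢iq jq≡iq = q≢r (val-injective i (≡.trans (≡.sym jq≡iq) q↦r))
    jr≢ir : val j r ≢ val i r
    jr≢ir jr≡ir = r≢p (val-injective i (≡.trans (≡.sym jr≡ir) r↦p))
    in-image : ∀ x → val j x ≢ val i x → ∃[ k ] x ≡ e k
    in-image x jx≢ix with any? (λ k → x ≟ᶠ e k)
    ... | yes k∈ = k∈
    ... | no  x∉ = contradiction (≡.sym (i~j x λ k ek≡x → x∉ (k , ≡.sym ek≡x))) jx≢ix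
    counted : (∃[ k ] p ≡ e k) → (∃[ k ] q ≡ e k) → (∃[ k ] r ≡ e k) →
              sum (λ k → eq (val j (e k)) (val i (e k))) ≈ fromℕ m
    counted (p′ , ≡.refl) (q′ , ≡.refl) (r′ , ≡.refl) =
      sum-all-but-three (λ k → eq (val j (e k)) (val i (e k)))
        (p≢q ∘ ≡.cong e , q≢r ∘ ≡.cong e , r≢p ∘ ≡.cong e)
        (⟦⟧-false (val j (e p′) ≟ᶠ val i (e p′)) jp≢ip)
        (⟦⟧-false (val j (e q′) ≟ᶠ val i (e q′)) jq≢iq)
        (⟦⟧-false (val j (e r′) ≟ᶠ val i (e r′)) jr≢ir)
        (λ k k≢p k≢q k≢r → ⟦⟧-true (val j (e k) ≟ᶠ val i (e k))
          (fixed (e k) (k≢p ∘ e-inj) (k≢q ∘ e-inj) (k≢r ∘ e-inj)))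

  -- Double counting: a 3-cycle within the image survives the omission of precisely those points of
  -- the image that it fixes.
  energy-ακ-∖ : ∀ {m} {e : Fin (3 ℕ.+ m) → Fin n} → Injective e → ∀ f →
    sum (λ k → energy (ακ (e ∖ k)) f) ≈ fromℕ m * energy (ακ e) f
  energy-ακ-∖ {m} {e} e-inj f = begin
    sum (λ k → energy (ακ (e ∖ k)) f)
      ≈⟨ energy-∑ (λ k → ακ (e ∖ k)) f ⟨
    energy (λ i j → sum λ k → ακ (e ∖ k) i j) f
      ≈⟨ energy-cong f pointwise ⟩
    energy (λ i j → fromℕ m * ακ e i j) f
      ≈⟨ energy-scale (fromℕ m) (ακ e) f ⟩
    fromℕ m * energy (ακ e) f ∎
    where
    pointwise : ∀ i j → sum (λ k → ακ (e ∖ k) i j) ≈ fromℕ m * ακ e i j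
    pointwise i j = begin
      sum (λ k → α i j * κ (e ∖ k) i j)
        ≈⟨ *-distribˡ-sum (α i j) (λ k → κ (e ∖ k) i j) ⟨
      α i j * sum (λ k → κ (e ∖ k) i j)
        ≈⟨ ⟦⟧-*-cong (i ∼? j) (λ i∼j → begin
             sum (λ k → κ (e ∖ k) i j)
               ≈⟨ sum-cong (λ k → κ-∖ e-inj k i j) ⟩
             sum (λ k → κ e i j * eq (val j (e k)) (val i (e k)))
               ≈⟨ *-distribˡ-sum (κ e i j) (λ k → eq (val j (e k)) (val i (e k))) ⟨
             κ e i j * sum (λ k → eq (val j (e k)) (val i (e k)))
               ≈⟨ ⟦⟧-*-cong (agree? e i j) (λ i~j → unmoved-count e-inj i∼j i~j) ⟩
             κ e i j * fromℕ m ∎) ⟩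
      α i j * (κ e i j * fromℕ m)
        ≈⟨ solve 3 (λ x y z → x :* (y :* z) := z :* (x :* y)) refl (α i j) (κ e i j) (fromℕ m) ⟩
      fromℕ m * ακ e i j ∎

  -- Every element other than the identity of the alternating group of three points is a 3-cycle,
  -- and the diagonal terms carry no energy.
  energy-three-points : ∀ {e : Fin 3 → Fin n} → Injective e → ∀ f → energy (κ e) f ≈ energy (ακ e) f
  energy-three-points {e} e-inj f = sum-cong λ i → sum-cong λ j → begin
    κ e i j * ((f i - f j) * (f i - f j))
      ≈⟨ ⟦⟧-*-cong (agree? e i j) (edge i j) ⟩
    κ e i j * (α i j * ((f i - f j) * (f i - f j)))
      ≈⟨ solve 3 (λ x y z → x :* (y :* z) := y :* x :* z) refl (κ e i j) (α i j) _ ⟩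
    ακ e i j * ((f i - f j) * (f i - f j)) ∎
    where
    edge : ∀ i j → Agree e i j → (f i - f j) * (f i - f j) ≈ α i j * ((f i - f j) * (f i - f j))
    edge i j i~j with i ≟ᶠ j
    ... | yes ≡.refl = solve 2 (λ x y → (x :- x) :* (x :- x) := y :* ((x :- x) :* (x :- x))) refl (f i) (α i i)
    ... | no i≢j = sym (trans (*-congʳ (⟦⟧-true (i ∼? j) i∼j)) (*-identityˡ _))
      where
      0≢1 : _≢_ {A = Fin 3} zero (suc zero)
      0≢1 ()
      1≢2 : _≢_ {A = Fin 3} (suc zero) (suc (suc zero))
      1≢2 ()
      2≢0 : _≢_ {A = Fin 3} (suc (suc zero)) zero
      2≢0 ()
      i∼j : i ∼ j
      i∼j = cycle⇒∼ (0≢1 ∘ e-inj , 1≢2 ∘ e-inj , 2≢0 ∘ e-inj) i≢j λ x x≢0 x≢1 x≢2 → i~j x λ where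
        zero             → x≢0 ∘ ≡.sym
        (suc zero)       → x≢1 ∘ ≡.sym
        (suc (suc zero)) → x≢2 ∘ ≡.sym

  -- The operator inequality multiplied by twice the order of the alternating group of the image.
  -- Sizes are written `3 + m`, so the constant s(s - 2) is the product of `3 + m` and `1 + m`.
  spectral-gap : ∀ {m} {e : Fin (3 ℕ.+ m) → Fin n} → Injective e → ∀ f →
    fromℕ (3 ℕ.+ m) * fromℕ (1 ℕ.+ m) * energy (κ e) f ≤ size e * energy (ακ e) f
  spectral-gap {zero} {e} e-inj f =
    ≤-respˡ (trans (*-comm _ _) (*-congʳ (sym (trans (*-congˡ (+-identityʳ 1#)) (*-identityʳ _)))))
      (≤-respʳ (trans (*-comm _ _) (*-congˡ (energy-three-points e-inj f)))
        (*-monoˡ-≤ (0≤energy (λ i j → 0≤⟦⟧ (agree? e i j)) f) 3≤size))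
    where
    -- Only this direction of |Alt(3)| = 3 is used: three times a class on two points, which has at
    -- least one member.
    3≤size : fromℕ 3 ≤ size e
    3≤size = ≤-respˡ (*-identityʳ (fromℕ 3)) (≤-respʳ (classSize-∖ e-inj o zero)
      (*-monoˡ-≤ (0≤fromℕ 3) (1≤classSize (e ∖ zero) o)))
  spectral-gap {suc m} {e} e-inj f = ≤-trans
    (≤-respˡ (sym (*-assoc M b E)) (≤-respʳ (sym (*-assoc M a (sum Eₖ))) (*-monoˡ-≤ (0≤fromℕ (4 ℕ.+ m)) (energy-stabilizers e-inj f))))
    -- The induction hypotheses are summed over the omitted point. The common factor `1 + m` is the
    -- number of points of the image fixed by a 3-cycle inside it; it is positive from four points
    -- on and is cancelled.
    (*-cancelˡ-≤ (0≤fromℕ (1 ℕ.+ m)) (fromℕ≉0 m)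
      (≤-respˡ lhs (≤-respʳ rhs (sum-mono λ k → *-monoˡ-≤ (0≤fromℕ (4 ℕ.+ m))
        (spectral-gap {m} {e ∖ k} (∖-injective {e = e} {k} e-inj) f)))))
    where
    M a b b′ E : Carrier
    M  = fromℕ (4 ℕ.+ m)
    a  = fromℕ (3 ℕ.+ m)
    b  = fromℕ (2 ℕ.+ m)
    b′ = fromℕ (1 ℕ.+ m)
    E  = energy (κ e) f
    Eₖ Dₖ : Vector Carrier (4 ℕ.+ m)
    Eₖ k = energy (κ (e ∖ k)) f
    Dₖ k = energy (ακ (e ∖ k)) f
    lhs : sum (λ k → M * (a * b′ * Eₖ k)) ≈ b′ * (M * a * sum Eₖ)
    lhs = begin
      sum (λ k → M * (a * b′ * Eₖ k))  ≈⟨ sum-cong (λ k → solve 4 (λ M a b x → M :* (a :* b :* x) := b :* (M :* a) :* x) refl M a b′ (Eₖ k)) ⟩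
      sum (λ k → b′ * (M * a) * Eₖ k)  ≈⟨ *-distribˡ-sum (b′ * (M * a)) Eₖ ⟨
      b′ * (M * a) * sum Eₖ            ≈⟨ *-assoc b′ (M * a) _ ⟩
      b′ * (M * a * sum Eₖ)            ∎
    rhs : sum (λ k → M * (size (e ∖ k) * Dₖ k)) ≈ b′ * (size e * energy (ακ e) f)
    rhs = begin
      sum (λ k → M * (size (e ∖ k) * Dₖ k))  ≈⟨ sum-cong (λ k → trans (sym (*-assoc M (size (e ∖ k)) (Dₖ k))) (*-congʳ (classSize-∖ e-inj o k))) ⟩
      sum (λ k → size e * Dₖ k)              ≈⟨ *-distribˡ-sum (size e) Dₖ ⟨
      size e * sum Dₖ                        ≈⟨ *-congˡ (energy-ακ-∖ e-inj f) ⟩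
      size e * (b′ * energy (ακ e) f)        ≈⟨ solve 3 (λ x y z → x :* (y :* z) := y :* (x :* z)) refl (size e) b′ _ ⟩
      b′ * (size e * energy (ακ e) f)        ∎

-- Reading off the first two entries of a spectrum.

module TopOfSpectrum {c ℓ₁ ℓ₂} (K : OrderedField c ℓ₁ ℓ₂) {N : ℕ} where
  open FieldProperties K
  open Solver using (solve; _:=_; _:+_; _:*_; _:-_; :-_; con)
  open Spectra K
  open SetoidReasoning setoid

  module _ {p} {U : Pred (Vector Carrier N) p} where

    dimension≢0 : HasDimension U 0 → ∀ {u} → U u → ∀ x → u x ≈ 0#
    dimension≢0 dim {u} Uu = proj₂ (HasDimension.spanning dim u Uu)

    basis≉0 : ∀ {k} (dim : HasDimension U (suc k)) → ¬ (∀ x → HasDimension.basis dim zero x ≈ 0#)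
    basis≉0 {k} dim b≈0 = 0≉1 (sym (independent a combination zero))
      where
      open HasDimension dim
      a : Vector Carrier (suc k)
      a zero    = 1#
      a (suc _) = 0#
      combination : ∀ x → linearCombination a basis x ≈ 0#
      combination x = trans (+-cong (trans (*-identityˡ _) (b≈0 x))
        (sum-zero λ i → zeroˡ (basis (suc i) x))) (+-identityˡ 0#)

    -- For constant vectors b₀ and b₁ the combination b₁(o) b₀ - b₀(o) b₁ vanishes. Independence
    -- then gives b₀(o) = 0, so b₀ is the zero vector, which no basis contains.
    constants-dimension : (∀ {u} → U u → ∀ x y → u x ≈ u y) → Fin N → ∀ {k} → ¬ HasDimension U (suc (suc k))
    constants-dimension constant o {k} dim = basis≉0 dim λ x → begin
      b₀ x      ≈⟨ constant (basis∈U zero) x o ⟩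
      b₀ o      ≈⟨ solve 1 (λ b → b := :- (:- b)) refl (b₀ o) ⟩
      - - b₀ o  ≈⟨ -‿cong (independent a combination (suc zero)) ⟩
      - 0#      ≈⟨ solve 0 (:- con (+ 0) := con (+ 0)) refl ⟩
      0#        ∎
      where
      open HasDimension dim
      b₀ b₁ : Vector Carrier N
      b₀ = basis zero
      b₁ = basis (suc zero)
      a : Vector Carrier (suc (suc k))
      a zero          = b₁ o
      a (suc zero)    = - b₀ o
      a (suc (suc _)) = 0#
      combination : ∀ x → linearCombination a basis x ≈ 0#
      combination x = begin
        b₁ o * b₀ x + (- b₀ o * b₁ x + sum (λ i → 0# * basis (suc (suc i)) x))
          ≈⟨ +-cong (*-congˡ (constant (basis∈U zero) x o)) (+-cong (*-congˡ (constant (basis∈U (suc zero)) x o))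
               (sum-zero λ i → zeroˡ (basis (suc (suc i)) x))) ⟩
        b₁ o * b₀ o + (- b₀ o * b₁ o + 0#)
          ≈⟨ solve 2 (λ x y → y :* x :+ ((:- x) :* y :+ con (+ 0)) := con (+ 0)) refl (b₀ o) (b₁ o) ⟩
        0# ∎

  -- In a decreasing list the first two entries are settled by four facts: `d` occurs, `θ` occurs,
  -- every entry is `d` or at most `θ`, and `d` occurs only once because its eigenvectors are
  -- constant.
  largest-two : ∀ {M : Matrix N} {d θ} → θ ≤ d → ¬ (d ≈ θ) → Fin N →
    (∃[ u ] Eigenspace M d u × ∃[ x ] ¬ (u x ≈ 0#)) →
    (∃[ u ] Eigenspace M θ u × ∃[ x ] ¬ (u x ≈ 0#)) →
    (∀ {μ u} → Eigenspace M μ u → ¬ (∀ x → u x ≈ 0#) → μ ≈ d ⊎ μ ≤ θ) →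
    (∀ {u} → Eigenspace M d u → ∀ x y → u x ≈ u y) →
    ∀ λs → IsSpectrum M λs → Prefix _≈_ (d ∷ θ ∷ []) λs
  largest-two {M} {d} {θ} θ≤d d≉θ o d-vector θ-vector dichotomy constant λs spectrum =
    prefix λs decreasing (occurs d-vector) (occurs θ-vector) (λ x∈ → dichotomous x∈) ≡.refl
    where
    open IsSpectrum spectrum

    -- A nonzero eigenvector excludes dimension 0, so filtering the list leaves an entry. It is only
    -- known to be equal to `μ` in the sense of `≈`.
    occurs : ∀ {μ} → (∃[ u ] Eigenspace M μ u × ∃[ x ] ¬ (u x ≈ 0#)) → ∃[ z ] z ∈ λs × z ≈ μ
    occurs {μ} (u , Uu , x , ux≉0) with filter (_≟ μ) λs in eq | multiplicities μ
    ... | []    | dim = contradiction (dimension≢0 dim Uu x) ux≉0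
    ... | z ∷ _ | _   = z , ∈-filter⁻ (_≟ μ) (≡.subst (z ∈_) (≡.sym eq) (here ≡.refl))

    dichotomous : ∀ {μ} → μ ∈ λs → μ ≈ d ⊎ μ ≤ θ
    dichotomous {μ} μ∈ with filter (_≟ μ) λs | multiplicities μ | ∈-filter⁺ (_≟ μ) μ∈ refl
    ... | _ ∷ _ | dim | _ = dichotomy (HasDimension.basis∈U dim zero) (basis≉0 dim)

    prefix : ∀ xs → Linked (λ x y → y ≤ x) xs → (∃[ z ] z ∈ xs × z ≈ d) → (∃[ z ] z ∈ xs × z ≈ θ) →
             (∀ {μ} → μ ∈ xs → μ ≈ d ⊎ μ ≤ θ) → xs ≡ λs → Prefix _≈_ (d ∷ θ ∷ []) xs
    prefix (x ∷ []) _ (_ , here ≡.refl , x≈d) (_ , here ≡.refl , x≈θ) _ _ =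
      contradiction (trans (sym x≈d) x≈θ) d≉θ
    prefix (x ∷ y ∷ zs) (y≤x ∷ linked) (z , z∈ , z≈d) (t , t∈ , t≈θ) bound xs≡ =
      d≈x ∷ ≤-antisym (≤-respˡ t≈θ (t≤y t∈)) y≤θ ∷ []
      where
      below : All (_≤ x) (x ∷ y ∷ zs)
      below = Linked⇒All (λ b≤a c≤b → ≤-trans c≤b b≤a) ≤-refl (y≤x ∷ linked)
      x≤d : x ≤ d
      x≤d with bound (here ≡.refl)
      ... | inj₁ x≈d = ≤-reflexive x≈d
      ... | inj₂ x≤θ = ≤-trans x≤θ θ≤d
      d≈x : d ≈ x
      d≈x = ≤-antisym (≤-respˡ z≈d (All.lookup below z∈)) x≤d
      -- The entry equal to `θ` cannot be the head, which is `d`; so it lies in the tail and is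
      -- bounded by the second entry.
      t≤y : t ∈ x ∷ y ∷ zs → t ≤ y
      t≤y (here ≡.refl) = contradiction (trans d≈x t≈θ) d≉θ
      t≤y (there t∈′)   = All.lookup (Linked⇒All (λ b≤a c≤b → ≤-trans c≤b b≤a) ≤-refl linked) t∈′
      y≤θ : y ≤ θ
      y≤θ with bound (there (here ≡.refl))
      ... | inj₂ y≤θ = y≤θ
      -- A second entry equal to `d` would give `d` multiplicity at least two, against the dimension
      -- bound for constants.
      ... | inj₁ y≈d = contradiction
        (≡.subst (HasDimension (Eigenspace M d))
          (≡.trans (≡.cong (multiplicity {N} d) (≡.sym xs≡))
            (≡.cong length (≡.trans (filter-accept (_≟ d) (sym d≈x)) (≡.cong (x ∷_) (filter-accept (_≟ d) y≈d)))))
          (multiplicities d))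
        (constants-dimension constant o)

-- Degree, the second eigenvector, and the bound on the remaining eigenvalues.

module Eigenvalues {c ℓ₁ ℓ₂} (K : OrderedField c ℓ₁ ℓ₂) {m N : ℕ} (F : PermutationFamily (3 ℕ.+ m) N) (o : Fin N) where
  open FieldProperties K
  open Solver using (solve; _:=_; _:+_; _:*_; _:-_; con)
  open QuadraticForms K {N}
  open PermutationFamily F
  open Agreement F
  open Counting K
  open SpectralGap K F o
  open Spectra K
  open SetoidReasoning setoid

  private
    n n-1 n-2 : Carrier
    n   = fromℕ (3 ℕ.+ m)
    n-1 = fromℕ (2 ℕ.+ m)
    n-2 = fromℕ (1 ℕ.+ m)

    all : Fin (3 ℕ.+ m) → Fin (3 ℕ.+ m)
    all x = x

    -- With all positions allowed there is a single class: `κ all` is the all-ones matrix, and its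
    -- quadratic form is the square of the sum of the vector.
    all-agree : ∀ {i j} → Agree all i j
    all-agree x x∉ = contradiction ≡.refl (x∉ x)

  eq-sum : ∀ i y → sum (λ b → eq (val i b) y) ≈ 1#
  eq-sum i y with val-surjective i y
  ... | b , ib≡y = trans
    (sum-single b λ b′ b′≢b → ⟦⟧-false (val i b′ ≟ᶠ y) (λ ib′≡y → b′≢b (val-injective i (≡.trans ib′≡y (≡.sym ib≡y)))))
    (⟦⟧-true (val i b ≟ᶠ y) ib≡y)

  eq-sum′ : ∀ i y → sum (λ b → eq y (val i b)) ≈ 1#
  eq-sum′ i y = trans (sum-cong λ b → eq-sym y (val i b)) (eq-sum i y)

  -- The point `a` is moved, so it is one of the three points of the cycle. After starting the cycle
  -- at `a`, the images of `a` and `b` identify the other two.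
  step-determined : ∀ {i j a b d} → i ∼ j → a ≢ b → val j a ≡ val i b → val j b ≡ val i d → CycleStep (val i) (val j) a b d
  step-determined {i} {j} {a} {b} {d} i∼j a≢b ja≡ib jb≡id with ∼⇒cycle i∼j
  ... | p , q , r , cycle = located (a ≟ᶠ p) (a ≟ᶠ q) (a ≟ᶠ r)
    where
    open CycleStep cycle
    located : Dec (a ≡ p) → Dec (a ≡ q) → Dec (a ≡ r) → CycleStep (val i) (val j) a b d
    located (yes ≡.refl) _ _
      with ≡.refl ← val-injective i (≡.trans (≡.sym p↦q) ja≡ib)
      with ≡.refl ← val-injective i (≡.trans (≡.sym q↦r) jb≡id) = cycle
    located (no _) (yes ≡.refl) _
      with ≡.refl ← val-injective i (≡.trans (≡.sym q↦r) ja≡ib)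
      with ≡.refl ← val-injective i (≡.trans (≡.sym r↦p) jb≡id) = record
        { distinct = proj₁ (proj₂ distinct) , proj₂ (proj₂ distinct) , proj₁ distinct
        ; p↦q = q↦r ; q↦r = r↦p ; r↦p = p↦q
        ; fixed = λ x x≢q x≢r x≢p → fixed x x≢p x≢q x≢r }
    located (no _) (no _) (yes ≡.refl)
      with ≡.refl ← val-injective i (≡.trans (≡.sym r↦p) ja≡ib)
      with ≡.refl ← val-injective i (≡.trans (≡.sym p↦q) jb≡id) = record
        { distinct = proj₂ (proj₂ distinct) , proj₁ distinct , proj₁ (proj₂ distinct)
        ; p↦q = r↦p ; q↦r = p↦q ; r↦p = q↦r
        ; fixed = λ x x≢r x≢p x≢q → fixed x x≢p x≢q x≢r }
    located (no a≢p) (no a≢q) (no a≢r) =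
      contradiction (val-injective i (≡.trans (≡.sym (fixed a a≢p a≢q a≢r)) ja≡ib)) a≢b

  cycle-unique : ∀ {i j j′ a b d} → CycleStep (val i) (val j) a b d → CycleStep (val i) (val j′) a b d → j ≡ j′
  cycle-unique {i} {j} {j′} {a} {b} {d} s s′ = val-extensional λ x → same x (x ≟ᶠ a) (x ≟ᶠ b) (x ≟ᶠ d)
    where
    module S = CycleStep s
    module S′ = CycleStep s′
    same : ∀ x → Dec (x ≡ a) → Dec (x ≡ b) → Dec (x ≡ d) → val j x ≡ val j′ x
    same x (yes ≡.refl) _ _ = ≡.trans S.p↦q (≡.sym S′.p↦q)
    same x _ (yes ≡.refl) _ = ≡.trans S.q↦r (≡.sym S′.q↦r)
    same x _ _ (yes ≡.refl) = ≡.trans S.r↦p (≡.sym S′.r↦p)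
    same x (no x≢a) (no x≢b) (no x≢d) = ≡.trans (S.fixed x x≢a x≢b x≢d) (≡.sym (S′.fixed x x≢a x≢b x≢d))

  -- A cycle of the positions a, b, d followed by `i` is `i` followed by the cycle of the values of
  -- `i` at these positions. So the neighbour is obtained from a translation supplied by `rotate`.
  cycle-exists : ∀ i {a b d} → Distinct₃ a b d → ∃[ j ] i ∼ j × CycleStep (val i) (val j) a b d
  cycle-exists i {a} {b} {d} dist@(a≢b , b≢d , d≢a)
    with rotate (a≢b ∘ val-injective i , b≢d ∘ val-injective i , d≢a ∘ val-injective i)
  ... | t , cycle = index t ⟨$⟩ʳ i , i∼j , step
    where
    open CycleStep cycle
    step : CycleStep (val i) (val (index t ⟨$⟩ʳ i)) a b d
    step = record
      { distinct = dist
      ; p↦q = ≡.trans (act t i a) p↦q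
      ; q↦r = ≡.trans (act t i b) q↦r
      ; r↦p = ≡.trans (act t i d) r↦p
      ; fixed = λ x x≢a x≢b x≢d → ≡.trans (act t i x)
          (fixed (val i x) (x≢a ∘ val-injective i) (x≢b ∘ val-injective i) (x≢d ∘ val-injective i))
      }
    i∼j : i ∼ (index t ⟨$⟩ʳ i)
    i∼j = cycle⇒∼ dist
      (λ i≡j → a≢b (val-injective i (≡.trans (≡.cong (λ l → val l a) i≡j) (CycleStep.p↦q step))))
      (λ x x≢a x≢b x≢d → ≡.sym (CycleStep.fixed step x x≢a x≢b x≢d))

  sum-remove-zero : ∀ {k} (g : Vector Carrier (suc k)) p → g p ≈ 0# → sum g ≈ sum (g ∘ punchIn p)
  sum-remove-zero g p gp≈0 = trans (sum-remove {i = p} g) (trans (+-congʳ gp≈0) (+-identityˡ _))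

  -- The number of 3-cycles with a ↦ b. These numbers form the quotient matrix through which `α`
  -- acts on functions of the image of one point.
  flow : Fin N → Fin (3 ℕ.+ m) → Fin (3 ℕ.+ m) → Carrier
  flow i a b = sum λ j → α i j * eq (val j a) (val i b)

  flow₂ : Fin N → Fin (3 ℕ.+ m) → Fin (3 ℕ.+ m) → Fin (3 ℕ.+ m) → Carrier
  flow₂ i a b d = sum λ j → α i j * eq (val j a) (val i b) * eq (val j b) (val i d)

  flow₂-zero : ∀ i a b d → (∀ {j} → i ∼ j → val j a ≡ val i b → val j b ≢ val i d) → flow₂ i a b d ≈ 0#
  flow₂-zero i a b d absurd = sum-zero λ j → term j (i ∼? j) (val j a ≟ᶠ val i b)
    where
    term : ∀ j (i∼j? : Dec (i ∼ j)) (ja≡ib? : Dec (val j a ≡ val i b)) →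
           ⟦ i∼j? ⟧ * ⟦ ja≡ib? ⟧ * eq (val j b) (val i d) ≈ 0#
    term j (no _) _ = trans (*-congʳ (zeroˡ _)) (zeroˡ _)
    term j (yes _) (no _) = trans (*-congʳ (zeroʳ _)) (zeroˡ _)
    term j (yes i∼j) (yes ja≡ib) = trans (*-congˡ (⟦⟧-false (val j b ≟ᶠ val i d) (absurd i∼j ja≡ib))) (zeroʳ _)

  flow₂-one : ∀ i {a b d} → Distinct₃ a b d → flow₂ i a b d ≈ 1#
  flow₂-one i {a} {b} {d} dist with cycle-exists i dist
  ... | j , i∼j , step = trans (sum-single j λ j′ j′≢j → term j′ j′≢j (i ∼? j′) (val j′ a ≟ᶠ val i b) (val j′ b ≟ᶠ val i d))
      (begin
        α i j * eq (val j a) (val i b) * eq (val j b) (val i d)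
          ≈⟨ *-cong (*-cong (⟦⟧-true (i ∼? j) i∼j) (⟦⟧-true (val j a ≟ᶠ val i b) (CycleStep.p↦q step)))
               (⟦⟧-true (val j b ≟ᶠ val i d) (CycleStep.q↦r step)) ⟩
        1# * 1# * 1#  ≈⟨ solve 0 (con (+ 1) :* con (+ 1) :* con (+ 1) := con (+ 1)) refl ⟩
        1#            ∎)
    where
    term : ∀ j′ → j′ ≢ j → (x? : Dec (i ∼ j′)) (y? : Dec (val j′ a ≡ val i b)) (z? : Dec (val j′ b ≡ val i d)) →
           ⟦ x? ⟧ * ⟦ y? ⟧ * ⟦ z? ⟧ ≈ 0#
    term j′ j′≢j (no _) _ _ = trans (*-congʳ (zeroˡ _)) (zeroˡ _)
    term j′ j′≢j (yes _) (no _) _ = trans (*-congʳ (zeroʳ _)) (zeroˡ _)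
    term j′ j′≢j (yes _) (yes _) (no _) = zeroʳ _
    term j′ j′≢j (yes i∼j′) (yes y) (yes z) =
      contradiction (cycle-unique (step-determined i∼j′ (proj₁ dist) y z) step) j′≢j

  -- A 3-cycle with a ↦ b is determined by the image of b, which is any of the points other than a
  -- and b.
  flow-off-diagonal : ∀ i {a b} → a ≢ b → flow i a b ≈ n-2
  flow-off-diagonal i {a} {b} a≢b = begin
    flow i a b
      ≈⟨ sum-cong (λ j → trans (sym (*-identityʳ _)) (*-congˡ (sym (eq-sum′ i (val j b))))) ⟩
    sum (λ j → α i j * eq (val j a) (val i b) * sum (λ d → eq (val j b) (val i d)))
      ≈⟨ sum-cong (λ j → *-distribˡ-sum (α i j * eq (val j a) (val i b)) (λ d → eq (val j b) (val i d))) ⟩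
    sum (λ j → sum λ d → α i j * eq (val j a) (val i b) * eq (val j b) (val i d))
      ≈⟨ ∑-comm (λ j d → α i j * eq (val j a) (val i b) * eq (val j b) (val i d)) ⟩
    sum (flow₂ i a b)
      ≈⟨ sum-remove-zero (flow₂ i a b) a (flow₂-zero i a b a λ i∼j ja≡ib jb≡ia →
           proj₂ (proj₂ (CycleStep.distinct (step-determined i∼j a≢b ja≡ib jb≡ia))) ≡.refl) ⟩
    sum (flow₂ i a b ∘ punchIn a)
      ≈⟨ sum-remove-zero (flow₂ i a b ∘ punchIn a) b′ (trans (reflexive (≡.cong (flow₂ i a b) b′≡)) (flow₂-zero i a b b λ {j} _ ja≡ib jb≡ib →
           a≢b (val-injective j (≡.trans ja≡ib (≡.sym jb≡ib))))) ⟩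
    sum (flow₂ i a b ∘ punchIn a ∘ punchIn b′)
      ≈⟨ sum-cong (λ d → flow₂-one i (a≢b , b≢ d , punchInᵢ≢i a _)) ⟩
    sum {1 ℕ.+ m} (λ _ → 1#)
      ≈⟨ trans (sum-const (1 ℕ.+ m) 1#) (*-identityʳ n-2) ⟩
    n-2 ∎
    where
    b′ : Fin (2 ℕ.+ m)
    b′ = punchOut a≢b
    b′≡ : punchIn a b′ ≡ b
    b′≡ = punchIn-punchOut a≢b
    b≢ : ∀ d → b ≢ punchIn a (punchIn b′ d)
    b≢ d b≡ = punchInᵢ≢i b′ d (≡.sym (punchIn-injective a _ _ (≡.trans b′≡ b≡)))

  flow-row : ∀ i a → sum (flow i a) ≈ sum (α i)
  flow-row i a = begin
    sum (λ b → sum λ j → α i j * eq (val j a) (val i b))  ≈⟨ ∑-comm (λ b j → α i j * eq (val j a) (val i b)) ⟩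
    sum (λ j → sum λ b → α i j * eq (val j a) (val i b))  ≈⟨ sum-cong (λ j → trans (sym (*-distribˡ-sum (α i j) (λ b → eq (val j a) (val i b))))
                                                              (trans (*-congˡ (eq-sum′ i (val j a))) (*-identityʳ _))) ⟩
    sum (α i)                                             ∎

  flow-diagonal : ∀ i a → sum (α i) ≈ flow i a a + n-1 * n-2
  flow-diagonal i a = begin
    sum (α i)                                       ≈⟨ flow-row i a ⟨
    sum (flow i a)                                  ≈⟨ sum-remove {i = a} (flow i a) ⟩
    flow i a a + sum (λ b → flow i a (punchIn a b)) ≈⟨ +-congˡ (sum-cong λ b → flow-off-diagonal i (punchInᵢ≢i a b ∘ ≡.sym)) ⟩
    flow i a a + sum {2 ℕ.+ m} (λ _ → n-2)          ≈⟨ +-congˡ (sum-const (2 ℕ.+ m) n-2) ⟩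
    flow i a a + n-1 * n-2                          ∎

  -- The degree s equals `flow i a a` plus (n - 1)(n - 2) for every a. Summed over a, the diagonal
  -- contributes (n - 3)s, because a 3-cycle fixes n - 3 points; subtracting leaves 3s.
  degree : ∀ i → fromℕ 3 * sum (α i) ≈ n * n-1 * n-2
  degree i = begin
    fromℕ 3 * s
      ≈⟨ solve 3 (λ t s x → t :* s := (t :+ x) :* s :- x :* s) refl (fromℕ 3) s (fromℕ m) ⟩
    (fromℕ 3 + fromℕ m) * s - fromℕ m * s
      ≈⟨ +-cong (*-congʳ (sym (fromℕ-+ 3 m))) (-‿cong (trans (*-comm (fromℕ m) s) (sym diagonals))) ⟩
    n * s - sum (λ a → flow i a a)
      ≈⟨ +-congʳ (trans (sum-cong λ a → sym (flow-diagonal i a)) (sum-const (3 ℕ.+ m) s)) ⟨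
    sum (λ a → flow i a a + n-1 * n-2) - sum (λ a → flow i a a)
      ≈⟨ +-congʳ (trans (∑-distrib-+ (λ a → flow i a a) (λ _ → n-1 * n-2)) (+-congˡ (sum-const (3 ℕ.+ m) (n-1 * n-2)))) ⟩
    sum (λ a → flow i a a) + n * (n-1 * n-2) - sum (λ a → flow i a a)
      ≈⟨ solve 4 (λ x a b d → x :+ a :* (b :* d) :- x := a :* b :* d) refl (sum (λ a → flow i a a)) n n-1 n-2 ⟩
    n * n-1 * n-2 ∎
    where
    s : Carrier
    s = sum (α i)
    diagonals : sum (λ a → flow i a a) ≈ s * fromℕ m
    diagonals = begin
      sum (λ a → sum λ j → α i j * eq (val j a) (val i a))
        ≈⟨ ∑-comm (λ a j → α i j * eq (val j a) (val i a)) ⟩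
      sum (λ j → sum λ a → α i j * eq (val j a) (val i a))
        ≈⟨ sum-cong (λ j → trans (sym (*-distribˡ-sum (α i j) (λ a → eq (val j a) (val i a))))
             (⟦⟧-*-cong (i ∼? j) λ i∼j → unmoved-count {e = all} (λ k≡l → k≡l) i∼j all-agree)) ⟩
      sum (λ j → α i j * fromℕ m)
        ≈⟨ *-distribʳ-sum (fromℕ m) (α i) ⟨
      s * fromℕ m ∎

  module _ {d : Carrier} (3d≈ : fromℕ 3 * d ≈ n * n-1 * n-2) where

    θ : Carrier
    θ = d - n * n-2

    α-row : RowSum α d
    α-row i = *-cancelˡ (fromℕ≉0 2) (trans (degree i) (sym 3d≈))

    α-sym : Symm α
    α-sym i j = ⟦⟧-cong (i ∼? j) (j ∼? i) ∼-sym ∼-sym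

    n*n-2≉0 : ¬ (n * n-2 ≈ 0#)
    n*n-2≉0 n*n-2≈0 = fromℕ≉0 m (*-cancelˡ-≈0 (fromℕ≉0 (2 ℕ.+ m)) n*n-2≈0)

    d≉θ : ¬ (d ≈ θ)
    d≉θ d≈θ = n*n-2≉0 (begin
      n * n-2              ≈⟨ solve 2 (λ d x → x := d :- (d :- x)) refl d (n * n-2) ⟩
      d - (d - n * n-2)    ≈⟨ +-congˡ (-‿cong (sym d≈θ)) ⟩
      d - d                ≈⟨ -‿inverseʳ d ⟩
      0#                   ∎)

    θ≤d : θ ≤ d
    θ≤d = 0≤y-x⇒x≤y (≤-respʳ (solve 2 (λ d x → x := d :- (d :- x)) refl d (n * n-2))
      (*-nonNegative (0≤fromℕ (3 ℕ.+ m)) (0≤fromℕ (1 ℕ.+ m))))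

    constant-vector : ∃[ u ] Eigenspace α d u × ∃[ x ] ¬ (u x ≈ 0#)
    constant-vector = (λ _ → 1#) ,
      (λ i → trans (sum-cong λ j → *-identityʳ (α i j)) (trans (α-row i) (sym (*-identityʳ d)))) ,
      o , λ 1≈0 → 0≉1 (sym 1≈0)

    -- The off-diagonal flow is constant, so on a zero-sum function of the image of a₀ the matrix
    -- acts as the diagonal flow minus n - 2. That is d - (n - 1)(n - 2) - (n - 2) = d - n(n - 2).
    position-vector : ∃[ u ] Eigenspace α θ u × ∃[ x ] ¬ (u x ≈ 0#)
    position-vector = u , eigen , o , λ uo≈0 → 0≉1 (sym (trans (sym uo≈1) uo≈0))
      where
      a₀ a₁ : Fin (3 ℕ.+ m)
      a₀ = zero
      a₁ = suc zero
      φ : Fin (3 ℕ.+ m) → Carrier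
      -- The difference of two indicators has zero sum over all values, and placing the first at the
      -- value of `o` makes the vector equal to 1 there.
      φ y = eq y (val o a₀) - eq y (val o a₁)
      u : Vector Carrier N
      u i = φ (val i a₀)
      0≢1 : a₀ ≢ a₁
      0≢1 ()
      uo≈1 : u o ≈ 1#
      uo≈1 = trans (+-cong (⟦⟧-true (val o a₀ ≟ᶠ val o a₀) ≡.refl)
          (-‿cong (⟦⟧-false (val o a₀ ≟ᶠ val o a₁) (0≢1 ∘ val-injective o))))
        (solve 0 (con (+ 1) :- con (+ 0) := con (+ 1)) refl)
      φ-sum : ∀ i → sum (φ ∘ val i) ≈ 0#
      φ-sum i = trans (sum-distrib-- (λ b → eq (val i b) (val o a₀)) (λ b → eq (val i b) (val o a₁)))
        (trans (+-cong (eq-sum i (val o a₀)) (-‿cong (eq-sum i (val o a₁)))) (-‿inverseʳ 1#))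
      expand : ∀ i y → φ y ≈ sum (λ b → eq y (val i b) * φ (val i b))
      expand i y = begin
        φ y                                        ≈⟨ *-identityˡ (φ y) ⟨
        1# * φ y                                   ≈⟨ *-congʳ (eq-sum′ i y) ⟨
        sum (λ b → eq y (val i b)) * φ y           ≈⟨ *-distribʳ-sum (φ y) (λ b → eq y (val i b)) ⟩
        sum (λ b → eq y (val i b) * φ y)           ≈⟨ sum-cong (λ b → ⟦⟧-*-cong (y ≟ᶠ val i b) λ y≡ib → reflexive (≡.cong φ y≡ib)) ⟩
        sum (λ b → eq y (val i b) * φ (val i b))   ∎
      eigen : Eigenspace α θ u
      eigen i = begin
        sum (λ j → α i j * φ (val j a₀))
          ≈⟨ sum-cong (λ j → trans (*-congˡ (expand i (val j a₀))) (*-distribˡ-sum (α i j) (λ b → eq (val j a₀) (val i b) * φ (val i b)))) ⟩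
        sum (λ j → sum λ b → α i j * (eq (val j a₀) (val i b) * φ (val i b)))
          ≈⟨ ∑-comm (λ j b → α i j * (eq (val j a₀) (val i b) * φ (val i b))) ⟩
        sum (λ b → sum λ j → α i j * (eq (val j a₀) (val i b) * φ (val i b)))
          ≈⟨ sum-cong (λ b → trans (sum-cong λ j → sym (*-assoc (α i j) (eq (val j a₀) (val i b)) (φ (val i b))))
               (sym (*-distribʳ-sum (φ (val i b)) (λ j → α i j * eq (val j a₀) (val i b))))) ⟩
        sum (λ b → flow i a₀ b * φ (val i b))
          ≈⟨ sum-remove {i = a₀} (λ b → flow i a₀ b * φ (val i b)) ⟩
        flow i a₀ a₀ * u i + sum (λ b → flow i a₀ (punchIn a₀ b) * φ (val i (punchIn a₀ b)))
          ≈⟨ +-congˡ (trans (sum-cong λ b → *-congʳ {x = φ (val i (punchIn a₀ b))} (flow-off-diagonal i {a₀} {punchIn a₀ b} (punchInᵢ≢i a₀ b ∘ ≡.sym)))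
               (sym (*-distribˡ-sum n-2 (λ b → φ (val i (punchIn a₀ b)))))) ⟩
        flow i a₀ a₀ * u i + n-2 * rest
          -- A term (n - 2) times `u i` is added to complete the zero sum and taken away again as
          -- n(n - 2) - (n - 1)(n - 2).
          ≈⟨ solve 4 (λ p u x r → p :* u :+ x :* r := (p :+ (con (+ 1) :+ x) :* x :- (con (+ 1) :+ (con (+ 1) :+ x)) :* x) :* u :+ x :* (u :+ r)) refl
               (flow i a₀ a₀) (u i) n-2 rest ⟩
        (flow i a₀ a₀ + n-1 * n-2 - n * n-2) * u i + n-2 * (u i + rest)
          ≈⟨ +-cong (*-congʳ (+-congʳ (trans (sym (flow-diagonal i a₀)) (α-row i))))
               (*-congˡ (trans (sym (sum-remove {i = a₀} (φ ∘ val i))) (φ-sum i))) ⟩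
        θ * u i + n-2 * 0#
          ≈⟨ solve 2 (λ x y → x :+ y :* con (+ 0) := x) refl (θ * u i) n-2 ⟩
        θ * u i ∎
        where
        rest : Carrier
        rest = sum λ b → φ (val i (punchIn a₀ b))

    module _ {μ f} (eigen : Eigenspace α μ f) where
      private
        w S q : Carrier
        w = size all
        S = sum f
        q = dot f f

      energy-α : energy α f ≈ (d - μ) * q + (d - μ) * q
      energy-α = trans (energy-expand α-sym α-row f) (+-cong half half)
        where
        half : d * q - dot f (α ⟨ f ⟩) ≈ (d - μ) * q
        half = begin
          d * q - dot f (α ⟨ f ⟩)  ≈⟨ +-congˡ (-‿cong (trans (dot-congʳ f eigen) (dot-scaleʳ f μ f))) ⟩
          d * q - μ * q            ≈⟨ solve 3 (λ d μ q → d :* q :- μ :* q := (d :- μ) :* q) refl d μ q ⟩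
          (d - μ) * q              ∎

      gap : n * n-2 * energy (κ all) f ≤ w * ((d - μ) * q + (d - μ) * q)
      gap = ≤-respʳ (*-congˡ (trans (energy-cong f λ i j → trans (*-congˡ (⟦⟧-true (agree? all i j) all-agree)) (*-identityʳ _)) energy-α))
        (spectral-gap {e = all} (λ k≡l → k≡l) f)

      -- For μ = d the right side of `gap` is zero. Every squared difference occurs in the energy of
      -- the all-ones kernel, so all of them vanish.
      top-constant : μ ≈ d → ∀ x y → f x ≈ f y
      top-constant μ≈d x y = x-y≈0⇒x≈y (x²≈0⇒x≈0 (begin
        (f x - f y) * (f x - f y)              ≈⟨ *-identityˡ _ ⟨
        1# * ((f x - f y) * (f x - f y))       ≈⟨ *-congʳ (⟦⟧-true (agree? all x y) all-agree) ⟨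
        κ all x y * ((f x - f y) * (f x - f y)) ≈⟨ sum≈0⇒term≈0 (0≤term x) (sum≈0⇒term≈0 (λ i → sum-nonNegative (0≤term i)) energy≈0 x) y ⟩
        0#                                     ∎))
        where
        0≤term : ∀ i j → 0# ≤ κ all i j * ((f i - f j) * (f i - f j))
        0≤term i j = *-nonNegative (0≤⟦⟧ (agree? all i j)) (0≤x² (f i - f j))
        energy≈0 : energy (κ all) f ≈ 0#
        energy≈0 = *-cancelˡ-≈0 n*n-2≉0 (≤-antisym
          (≤-respʳ (begin
            w * ((d - μ) * q + (d - μ) * q)  ≈⟨ *-congˡ (+-cong (*-congʳ (+-congˡ (-‿cong μ≈d))) (*-congʳ (+-congˡ (-‿cong μ≈d)))) ⟩
            w * ((d - d) * q + (d - d) * q)  ≈⟨ solve 3 (λ w d q → w :* ((d :- d) :* q :+ (d :- d) :* q) := con (+ 0)) refl w d q ⟩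
            0#                               ∎) gap)
          (*-nonNegative (*-nonNegative (0≤fromℕ (3 ℕ.+ m)) (0≤fromℕ (1 ℕ.+ m)))
            (0≤energy (λ i j → 0≤⟦⟧ (agree? all i j)) f)))

      -- An eigenvector for another eigenvalue is orthogonal to the constants, since `α` is
      -- symmetric.
      sum≈0 : ¬ (μ ≈ d) → S ≈ 0#
      sum≈0 μ≉d = *-cancelˡ-≈0 (λ d-μ≈0 → μ≉d (sym (x-y≈0⇒x≈y d-μ≈0))) (begin
        (d - μ) * S
          ≈⟨ solve 3 (λ d μ S → (d :- μ) :* S := d :* S :- μ :* S) refl d μ S ⟩
        d * S - μ * S
          ≈⟨ +-cong (*-distribˡ-sum d f) (-‿cong (*-distribˡ-sum μ f)) ⟩
        sum (λ i → d * f i) - sum (λ i → μ * f i)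
          ≈⟨ +-cong (sum-cong λ i → *-congʳ (trans (sum-cong λ j → *-identityʳ (α i j)) (α-row i)))
               (-‿cong (sum-cong λ i → trans (*-identityˡ _) (eigen i))) ⟨
        dot (α ⟨ one ⟩) f - dot one (α ⟨ f ⟩)
          ≈⟨ +-congʳ (⟨⟩-dot α-sym one f) ⟩
        dot one (α ⟨ f ⟩) - dot one (α ⟨ f ⟩)
          ≈⟨ -‿inverseʳ _ ⟩
        0# ∎)
        where
        one : Vector Carrier N
        one _ = 1#

      -- On vectors of zero sum the all-ones kernel has energy 2wq. Then `gap` bounds n(n - 2) by d
      -- - μ after cancelling 2wq, which is nonzero because the vector is.
      below-top : ¬ (μ ≈ d) → ¬ (∀ x → f x ≈ 0#) → μ ≤ θ
      below-top μ≉d f≉0 = 0≤y-x⇒x≤y (≤-respʳ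
          (solve 3 (λ d μ x → d :- μ :- x := d :- x :- μ) refl d μ (n * n-2))
          (x≤y⇒0≤y-x (*-cancelˡ-≤ 0≤2wq 2wq≉0 (≤-respˡ lhs (≤-respʳ rhs gap)))))
        where
        2wq : Carrier
        2wq = w * q + w * q
        0≤wq : 0# ≤ w * q
        0≤wq = *-nonNegative (0≤size all) (0≤dot f)
        0≤2wq : 0# ≤ 2wq
        0≤2wq = +-nonNegative 0≤wq 0≤wq
        2wq≉0 : ¬ (2wq ≈ 0#)
        2wq≉0 2wq≈0 = f≉0 (dot≈0⇒≈0 (*-cancelˡ-≈0 (size≉0 all) (*-cancelˡ-≈0 (fromℕ≉0 1)
          (trans (solve 1 (λ x → (con (+ 1) :+ (con (+ 1) :+ con (+ 0))) :* x := x :+ x) refl (w * q)) 2wq≈0))))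
        κf≈0 : ∀ i → (κ all ⟨ f ⟩) i ≈ 0#
        κf≈0 i = trans (sum-cong λ j → trans (*-congʳ (⟦⟧-true (agree? all i j) all-agree)) (*-identityˡ (f j))) (sum≈0 μ≉d)
        lhs : n * n-2 * energy (κ all) f ≈ 2wq * (n * n-2)
        lhs = begin
          n * n-2 * energy (κ all) f
            ≈⟨ *-congˡ (energy-expand (κ-sym all) (λ i → classSize-const all i o) f) ⟩
          n * n-2 * ((w * q - z) + (w * q - z))
            ≈⟨ *-congˡ (+-cong (+-congˡ (-‿cong z≈0)) (+-congˡ (-‿cong z≈0))) ⟩
          n * n-2 * ((w * q - 0#) + (w * q - 0#))
            ≈⟨ solve 2 (λ x y → x :* ((y :- con (+ 0)) :+ (y :- con (+ 0))) := (y :+ y) :* x) refl (n * n-2) (w * q) ⟩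
          2wq * (n * n-2) ∎
          where
          z : Carrier
          z = dot f (κ all ⟨ f ⟩)
          z≈0 : z ≈ 0#
          z≈0 = dot-zeroʳ f κf≈0
        rhs : w * ((d - μ) * q + (d - μ) * q) ≈ 2wq * (d - μ)
        rhs = solve 3 (λ w x q → w :* (x :* q :+ x :* q) := (w :* q :+ w :* q) :* x) refl w (d - μ) q

    α-largest-two : ∀ λs → IsSpectrum α λs → Prefix _≈_ (d ∷ θ ∷ []) λs
    α-largest-two = TopOfSpectrum.largest-two K θ≤d d≉θ o constant-vector position-vector
      (λ {μ} eigen f≉0 → case μ eigen f≉0 (μ ≟ d))
      (λ eigen → top-constant eigen refl)
      where
      case : ∀ μ {f} → Eigenspace α μ f → ¬ (∀ x → f x ≈ 0#) → Dec (μ ≈ d) → μ ≈ d ⊎ μ ≤ θ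
      case μ eigen f≉0 (yes μ≈d) = inj₁ μ≈d
      case μ eigen f≉0 (no μ≉d)  = inj₂ (below-top eigen μ≉d f≉0)

-- Transpositions and the parity of permutations.

module _ {n : ℕ} where

  transpose-first : ∀ (i j : Fin n) → PC.transpose i j i ≡ j
  transpose-first i j rewrite dec-true (i ≟ᶠ i) ≡.refl = ≡.refl

  transpose-second : ∀ (i j : Fin n) → PC.transpose i j j ≡ i
  transpose-second i j with j ≟ᶠ i
  ... | yes j≡i = j≡i
  ... | no  _ rewrite dec-true (j ≟ᶠ j) ≡.refl = ≡.refl

  transpose-other : ∀ {i j k : Fin n} → k ≢ i → k ≢ j → PC.transpose i j k ≡ k
  transpose-other {i} {j} {k} k≢i k≢j
    rewrite dec-false (k ≟ᶠ i) k≢i | dec-false (k ≟ᶠ j) k≢j = ≡.refl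

  permutation-injective : ∀ (π : Permutation′ n) → Injective (π ⟨$⟩ʳ_)
  permutation-injective π πk≡πl =
    ≡.trans (≡.sym (Perm.inverseˡ π)) (≡.trans (≡.cong (π ⟨$⟩ˡ_) πk≡πl) (Perm.inverseˡ π))

module Parity where
  open CommutativeMonoidSum (CommutativeRing.+-commutativeMonoid xor-∧-commutativeRing)
    using (sum; sum-cong-≗; sum-permute)
  open ≡.≡-Reasoning

  _<ᵇ_ : ∀ {m} → Fin m → Fin m → Bool
  i <ᵇ j = does (i <ᶠ? j)

  <ᵇ-flip : ∀ {m} {i j : Fin m} → i ≢ j → j <ᵇ i ≡ not (i <ᵇ j)
  <ᵇ-flip {i = i} {j} i≢j with <-cmp i j
  ... | tri< i<j _ j≮i = ≡.trans (dec-false (j <ᶠ? i) j≮i) (≡.sym (≡.cong not (dec-true (i <ᶠ? j) i<j)))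
  ... | tri≈ _ i≡j _   = contradiction i≡j i≢j
  ... | tri> i≮j _ j<i = ≡.trans (dec-true (j <ᶠ? i) j<i) (≡.sym (≡.cong not (dec-false (i <ᶠ? j) i≮j)))

  ascents : ∀ {n m} → (Fin (suc n) → Fin m) → Bool
  ascents f = sum λ j → f zero <ᵇ f (suc j)

  -- The parity of the number of pairs i < j with f i < f j.
  sign : ∀ {n m} → (Fin n → Fin m) → Bool
  sign {zero}  f = false
  sign {suc n} f = ascents f xor sign (f ∘ suc)

  sign-cong : ∀ {n m} {f g : Fin n → Fin m} → f ≗ g → sign f ≡ sign g
  sign-cong {zero}  f≗g = ≡.refl
  sign-cong {suc n} f≗g = ≡.cong₂ _xor_
    (sum-cong-≗ λ j → ≡.cong₂ _<ᵇ_ (f≗g zero) (f≗g (suc j))) (sign-cong (f≗g ∘ suc))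

  -- The target of f has its own size so that the recursion can pass to `f ∘ suc`, whose domain
  -- shrinks while its target stays.
  Flips : ∀ {n} → (Fin n → Fin n) → Set
  Flips {n} τ = ∀ {m} (f : Fin n → Fin m) → Injective f → sign (f ∘ τ) ≡ not (sign f)

  -- Position zero stays in place, so its row of comparisons is merely permuted and its sum is
  -- unchanged.
  flips-suc : ∀ {n} (a b : Fin n) → Flips (PC.transpose a b) → Flips (PC.transpose (suc a) (suc b))
  flips-suc a b flips f f-inj = begin
    sign (f ∘ PC.transpose (suc a) (suc b))
      ≡⟨ sign-cong (λ k → ≡.cong f (Perm.lift₀-transpose a b k)) ⟩
    ascents (f ∘ (Perm.lift₀ (Perm.transpose a b) ⟨$⟩ʳ_)) xor sign (f ∘ suc ∘ PC.transpose a b)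
      ≡⟨ ≡.cong₂ _xor_ (≡.sym (sum-permute (λ j → f zero <ᵇ f (suc j)) (Perm.transpose a b)))
           (flips (f ∘ suc) (λ k≡l → suc-inj (f-inj k≡l))) ⟩
    ascents f xor not (sign (f ∘ suc))
      ≡⟨ not-distribʳ-xor (ascents f) (sign (f ∘ suc)) ⟨
    not (sign f) ∎
    where
    suc-inj : ∀ {n} {k l : Fin n} → suc k ≡ suc l → k ≡ l
    suc-inj ≡.refl = ≡.refl

  0≢1 : ∀ {n} → _≢_ {A = Fin (suc (suc n))} zero (suc zero)
  0≢1 ()

  -- The two rows of comparisons with later positions are exchanged, and only the comparison between
  -- the first two positions is negated.
  flips-01 : ∀ {n} → Flips (PC.transpose {suc (suc n)} zero (suc zero))
  flips-01 {n} {m} f f-inj = begin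
    sign {suc (suc n)} {m} (f ∘ PC.transpose zero (suc zero))
      ≡⟨⟩
    ((f (suc zero) <ᵇ f zero) xor p₁) xor (p₀ xor s)
      ≡⟨ ≡.cong (λ c → (c xor p₁) xor (p₀ xor s)) (<ᵇ-flip (λ f0≡f1 → 0≢1 (f-inj f0≡f1))) ⟩
    (not c xor p₁) xor (p₀ xor s)
      ≡⟨ rearrange c p₀ p₁ s ⟩
    not (sign {suc (suc n)} {m} f) ∎
    where
    c  = f zero <ᵇ f (suc zero)
    p₀ = sum λ j → f zero <ᵇ f (suc (suc j))
    p₁ = sum λ j → f (suc zero) <ᵇ f (suc (suc j))
    s  = sign {n} {m} λ j → f (suc (suc j))
    rearrange : ∀ c p q s → (not c xor q) xor (p xor s) ≡ not ((c xor p) xor (q xor s))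
    rearrange false false false s = ≡.refl
    rearrange false false true  s = ≡.sym (not-involutive s)
    rearrange false true  false s = ≡.refl
    rearrange false true  true  s = ≡.sym (≡.cong not (not-involutive s))
    rearrange true  false false s = ≡.sym (not-involutive s)
    rearrange true  false true  s = ≡.sym (≡.cong not (not-involutive s))
    rearrange true  true  false s = ≡.refl
    rearrange true  true  true  s = ≡.refl

  flips-conjugate : ∀ {n} {σ τ : Permutation′ n} → Flips (σ ⟨$⟩ʳ_) → Flips (τ ⟨$⟩ʳ_) →
                    Flips ((σ ⟨$⟩ʳ_) ∘ (τ ⟨$⟩ʳ_) ∘ (σ ⟨$⟩ʳ_))
  flips-conjugate {σ = σ} {τ} σ-flips τ-flips f f-inj = begin
    sign (f ∘ (σ ⟨$⟩ʳ_) ∘ (τ ⟨$⟩ʳ_) ∘ (σ ⟨$⟩ʳ_))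
      ≡⟨ σ-flips (f ∘ (σ ⟨$⟩ʳ_) ∘ (τ ⟨$⟩ʳ_)) (permutation-injective τ ∘ permutation-injective σ ∘ f-inj) ⟩
    not (sign (f ∘ (σ ⟨$⟩ʳ_) ∘ (τ ⟨$⟩ʳ_)))  ≡⟨ ≡.cong not (τ-flips (f ∘ (σ ⟨$⟩ʳ_)) (permutation-injective σ ∘ f-inj)) ⟩
    not (not (sign (f ∘ (σ ⟨$⟩ʳ_))))        ≡⟨ not-involutive _ ⟩
    sign (f ∘ (σ ⟨$⟩ʳ_))                    ≡⟨ σ-flips f f-inj ⟩
    not (sign f)                            ∎

  -- The transposition (0 , b + 2) is the conjugate by (0 , 1) of (1 , b + 2), which in turn is the
  -- shift of (0 , b + 1).
  flips-zero : ∀ {n} (b : Fin n) → Flips (PC.transpose zero (suc b))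
  flips-zero zero = flips-01
  flips-zero (suc b) f f-inj = ≡.trans (sign-cong (≡.cong f ∘ conjugate))
    (flips-conjugate {σ = Perm.transpose zero (suc zero)} {Perm.transpose (suc zero) (suc (suc b))}
      flips-01 (flips-suc zero (suc b) (flips-zero b)) f f-inj)
    where
    conjugate : ∀ k → PC.transpose zero (suc (suc b)) k ≡
      PC.transpose zero (suc zero) (PC.transpose (suc zero) (suc (suc b)) (PC.transpose zero (suc zero) k))
    conjugate zero = ≡.refl
    conjugate (suc zero) = ≡.refl
    conjugate (suc (suc k)) with does (k ≟ᶠ b)
    ... | true  = ≡.refl
    ... | false = ≡.refl

  flips-transpose : ∀ {n} {a b : Fin n} → a ≢ b → Flips (PC.transpose a b)
  flips-transpose {a = zero}  {zero}  a≢b = contradiction ≡.refl a≢b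
  flips-transpose {a = zero}  {suc b} a≢b = flips-zero b
  flips-transpose {a = suc a} {suc b} a≢b = flips-suc a b (flips-transpose (a≢b ∘ ≡.cong suc))
  flips-transpose {a = suc a} {zero}  a≢b f f-inj =
    ≡.trans (sign-cong (≡.cong f ∘ symmetric)) (flips-zero a f f-inj)
    where
    symmetric : ∀ k → PC.transpose (suc a) zero k ≡ PC.transpose zero (suc a) k
    symmetric zero = ≡.refl
    symmetric (suc k) with does (k ≟ᶠ a)
    ... | true  = ≡.refl
    ... | false = ≡.refl

  isOdd : ℕ → Bool
  isOdd zero    = false
  isOdd (suc k) = not (isOdd k)

  isOdd-*2 : ∀ k → isOdd (k ℕ.* 2) ≡ false
  isOdd-*2 zero    = ≡.refl
  isOdd-*2 (suc k) = ≡.trans (not-involutive _) (isOdd-*2 k)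

  -- As `sign` counts ascents and not inversions, the identity itself has the parity of n(n - 1)/2;
  -- parities are therefore measured relative to `sign id`.
  sign-eval : ∀ {n} (ts : TranspositionList n) → All (uncurry _≢_) ts →
              sign (eval ts ⟨$⟩ʳ_) ≡ isOdd (length ts) xor sign {n} {n} id
  sign-eval {n} []             []           = ≡.refl
  sign-eval {n} ((i , j) ∷ ts) (i≢j ∷ all≢) = begin
    sign ((eval ts ⟨$⟩ʳ_) ∘ PC.transpose i j)  ≡⟨ flips-transpose i≢j (eval ts ⟨$⟩ʳ_) (permutation-injective (eval ts)) ⟩
    not (sign (eval ts ⟨$⟩ʳ_))                 ≡⟨ ≡.cong not (sign-eval ts all≢) ⟩
    not (isOdd (length ts) xor sign {n} {n} id)        ≡⟨ not-distribˡ-xor (isOdd (length ts)) (sign {n} {n} id) ⟩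
    not (isOdd (length ts)) xor sign {n} {n} id        ∎

  sign-even : ∀ {n} {π : Permutation′ n} → IsEven π → sign (π ⟨$⟩ʳ_) ≡ sign {n} {n} id
  sign-even {n} (ts , ts≢ , divides k len≡ , π≈) = begin
    _                                ≡⟨ sign-cong π≈ ⟩
    sign (eval ts ⟨$⟩ʳ_)             ≡⟨ sign-eval ts ts≢ ⟩
    isOdd (length ts) xor sign {n} {n} id    ≡⟨ ≡.cong (_xor sign {n} {n} id) (≡.trans (≡.cong isOdd len≡) (isOdd-*2 k)) ⟩
    sign {n} {n} id                      ∎

  transposition-not-even : ∀ {n} {π : Permutation′ n} → IsEven π → ∀ {a b} → a ≢ b →
                           ¬ (∀ x → π ⟨$⟩ʳ x ≡ PC.transpose a b x)
  transposition-not-even {π = π} π-even a≢b π≈ = not-¬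
    (sign-even {π = π} π-even) (≡.trans (sign-cong π≈) (flips-transpose a≢b id (λ k≡l → k≡l)))

open Parity using (transposition-not-even)

-- Even permutations moving at most three points.

module _ {n : ℕ} {π : Permutation′ n} (π-even : IsEven π) where
  private
    f : Fin n → Fin n
    f = π ⟨$⟩ʳ_
    f-inj : Injective f
    f-inj = permutation-injective π

    FixedBeyond₂ : Fin n → Fin n → Set
    FixedBeyond₂ a b = ∀ x → x ≢ a → x ≢ b → f x ≡ x

    FixedBeyond₃ : Fin n → Fin n → Fin n → Set
    FixedBeyond₃ a b d = ∀ x → x ≢ a → x ≢ b → x ≢ d → f x ≡ x

    moves₂ : ∀ {a b} → FixedBeyond₂ a b → f a ≢ a → f a ≡ b
    moves₂ {a} {b} fixed fa≢a with f a ≟ᶠ b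
    ... | yes fa≡b = fa≡b
    ... | no  fa≢b = contradiction (f-inj (fixed (f a) fa≢a fa≢b)) fa≢a

    moves₃ : ∀ {a b d} → FixedBeyond₃ a b d → f a ≢ a → f a ≡ b ⊎ f a ≡ d
    moves₃ {a} {b} {d} fixed fa≢a with f a ≟ᶠ b | f a ≟ᶠ d
    ... | yes fa≡b | _        = inj₁ fa≡b
    ... | no _     | yes fa≡d = inj₂ fa≡d
    ... | no fa≢b  | no fa≢d  = contradiction (f-inj (fixed (f a) fa≢a fa≢b fa≢d)) fa≢a

    clash : ∀ {x y z} → f x ≡ z → f y ≡ z → x ≡ y
    clash fx≡z fy≡z = f-inj (≡.trans fx≡z (≡.sym fy≡z))

  even-fixes-two : ∀ {a b} → a ≢ b → FixedBeyond₂ a b → f a ≡ a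
  even-fixes-two {a} {b} a≢b fixed with f a ≟ᶠ a
  ... | yes fa≡a = fa≡a
  ... | no  fa≢a = contradiction transposed (transposition-not-even {π = π} π-even a≢b)
    where
    fa≡b : f a ≡ b
    fa≡b = moves₂ fixed fa≢a
    fb≡a : f b ≡ a
    fb≡a = moves₂ (λ x x≢b x≢a → fixed x x≢a x≢b) (λ fb≡b → a≢b (clash fa≡b fb≡b))
    transposed : ∀ x → f x ≡ PC.transpose a b x
    transposed x = case (x ≟ᶠ a) (x ≟ᶠ b)
      where
      case : Dec (x ≡ a) → Dec (x ≡ b) → f x ≡ PC.transpose a b x
      case (yes ≡.refl) _          = ≡.trans fa≡b (≡.sym (transpose-first a b))
      case _ (yes ≡.refl)          = ≡.trans fb≡a (≡.sym (transpose-second a b))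
      case (no x≢a) (no x≢b)       = ≡.trans (fixed x x≢a x≢b) (≡.sym (transpose-other x≢a x≢b))

  even-identity : ∀ {a b d} → Distinct₃ a b d → FixedBeyond₃ a b d → f a ≡ a → ∀ x → f x ≡ x
  even-identity {a} {b} {d} (a≢b , b≢d , d≢a) fixed fa≡a x = case (x ≟ᶠ b) (x ≟ᶠ d)
    where
    fixed₂ : FixedBeyond₂ b d
    fixed₂ x x≢b x≢d with x ≟ᶠ a
    ... | yes ≡.refl = fa≡a
    ... | no  x≢a    = fixed x x≢a x≢b x≢d
    case : Dec (x ≡ b) → Dec (x ≡ d) → f x ≡ x
    case (yes ≡.refl) _    = even-fixes-two b≢d fixed₂
    case _ (yes ≡.refl)    = even-fixes-two (b≢d ∘ ≡.sym) (λ x x≢d x≢b → fixed₂ x x≢b x≢d)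
    case (no x≢b) (no x≢d) = fixed₂ x x≢b x≢d

  -- If one of the three points were fixed, at most two could move and evenness would force the
  -- identity. So each goes to one of the other two: of the eight choices two are cyclic, and the
  -- other six send two points to the same place.
  even-cycle : ∀ {a b d} → Distinct₃ a b d → FixedBeyond₃ a b d → ¬ (∀ x → f x ≡ x) →
               IsCycle a b d π ⊎ IsCycle a d b π
  even-cycle {a} {b} {d} dist@(a≢b , b≢d , d≢a) fixed π≉id
    with moves₃ fixed fa≢a | moves₃ (λ x x≢b x≢d x≢a → fixed x x≢a x≢b x≢d) fb≢b
       | moves₃ (λ x x≢d x≢a x≢b → fixed x x≢a x≢b x≢d) fd≢d
    where
    fa≢a : f a ≢ a
    fa≢a fa≡a = π≉id (even-identity dist fixed fa≡a)
    fb≢b : f b ≢ b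
    fb≢b fb≡b = π≉id (even-identity (b≢d , d≢a , a≢b) (λ x x≢b x≢d x≢a → fixed x x≢a x≢b x≢d) fb≡b)
    fd≢d : f d ≢ d
    fd≢d fd≡d = π≉id (even-identity (d≢a , a≢b , b≢d) (λ x x≢d x≢a x≢b → fixed x x≢a x≢b x≢d) fd≡d)
  ... | inj₁ fa≡b | inj₁ fb≡d | inj₁ fd≡a = inj₁ (fa≡b , fb≡d , fd≡a , fixed)
  ... | inj₂ fa≡d | inj₂ fb≡a | inj₂ fd≡b = inj₂ (fa≡d , fd≡b , fb≡a , λ x x≢a x≢d x≢b → fixed x x≢a x≢b x≢d)
  ... | inj₁ fa≡b | _         | inj₂ fd≡b = contradiction (clash fd≡b fa≡b) d≢a
  ... | _         | inj₂ fb≡a | inj₁ fd≡a = contradiction (clash fb≡a fd≡a) b≢d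
  ... | inj₂ fa≡d | inj₁ fb≡d | _         = contradiction (clash fa≡d fb≡d) a≢b

module _ {n : ℕ} {π : Permutation′ n} where

  isCycle-rotate : ∀ {a b d} → IsCycle a b d π → IsCycle b d a π
  isCycle-rotate (a↦b , b↦d , d↦a , fixed) = b↦d , d↦a , a↦b , λ x x≢b x≢d x≢a → fixed x x≢a x≢b x≢d

  -- `T₃` lists cycles by increasing triples and an orientation, so the three points are sorted and
  -- the cycle is rotated accordingly.
  cycle∈T₃ : ∀ (π-even : IsEven π) {a b d} → Distinct₃ a b d → IsCycle a b d π → T₃ (π , π-even)
  cycle∈T₃ _ {a} {b} {d} (a≢b , b≢d , d≢a) cycle with <-cmp a b | <-cmp b d | <-cmp d a
  ... | tri≈ _ a≡b _ | _ | _ = contradiction a≡b a≢b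
  ... | _ | tri≈ _ b≡d _ | _ = contradiction b≡d b≢d
  ... | _ | _ | tri≈ _ d≡a _ = contradiction d≡a d≢a
  ... | tri< a<b _ _ | tri< b<d _ _ | _            = a , b , d , a<b , b<d , inj₁ cycle
  ... | tri< a<b _ _ | tri> _ _ d<b | tri< d<a _ _ = d , a , b , d<a , a<b , inj₁ (isCycle-rotate (isCycle-rotate cycle))
  ... | tri< a<b _ _ | tri> _ _ d<b | tri> _ _ a<d = a , d , b , a<d , d<b , inj₂ cycle
  ... | tri> _ _ b<a | tri< b<d _ _ | tri< d<a _ _ = b , d , a , b<d , d<a , inj₁ (isCycle-rotate cycle)
  ... | tri> _ _ b<a | tri< b<d _ _ | tri> _ _ a<d = b , a , d , b<a , a<d , inj₂ (isCycle-rotate cycle)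
  ... | tri> _ _ b<a | tri> _ _ d<b | _            = d , b , a , d<b , b<a , inj₂ (isCycle-rotate (isCycle-rotate cycle))

-- The alternating group as a numbered family.

module AlternatingFamily {n N : ℕ} (lab : Graph.Labelling (CAG n) N) where
  open Inverse lab using (to; from; from-cong; strictlyInverseˡ; strictlyInverseʳ)
  open Group (A n) using (Carrier; _∙_; _⁻¹)
  open Graph (CAG n) using (_∼_; _∼?_; ∼-sym)

  val : Fin N → Fin n → Fin n
  val i x = proj₁ (to i) ⟨$⟩ʳ x

  val-extensional : ∀ {i j} → (∀ x → val i x ≡ val j x) → i ≡ j
  val-extensional {i} {j} i≈j =
    ≡.trans (≡.sym (strictlyInverseʳ i)) (≡.trans (from-cong {to i} {to j} i≈j) (strictlyInverseʳ j))

  rightTranslation : Carrier → Translation val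
  rightTranslation u = record
    { index = permutation (λ l → from (to l ∙ u)) (λ l → from (to l ∙ u ⁻¹))
        (λ l → val-extensional λ x → ≡.trans (strictlyInverseˡ (to (from (to l ∙ u ⁻¹)) ∙ u) x)
          (≡.trans (≡.cong (proj₁ u ⟨$⟩ʳ_) (strictlyInverseˡ (to l ∙ u ⁻¹) x)) (Perm.inverseʳ (proj₁ u))))
        (λ l → val-extensional λ x → ≡.trans (strictlyInverseˡ (to (from (to l ∙ u)) ∙ u ⁻¹) x)
          (≡.trans (≡.cong (proj₁ u ⟨$⟩ˡ_) (strictlyInverseˡ (to l ∙ u) x)) (Perm.inverseˡ (proj₁ u))))
    ; value = proj₁ u ⟨$⟩ʳ_
    ; value-injective = permutation-injective (proj₁ u)
    ; act = λ l x → strictlyInverseˡ (to l ∙ u) x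
    }

  rotate : ∀ {a b d} → Distinct₃ a b d → Σ[ t ∈ Translation val ] CycleStep id (Translation.value t) a b d
  rotate {a} {b} {d} dist@(a≢b , b≢d , d≢a) =
    -- Read left to right, (a b)(a d) is the cycle a ↦ b ↦ d ↦ a, and two transpositions make an
    -- even permutation.
    rightTranslation (eval ts , ts , a≢b ∷ d≢a ∘ ≡.sym ∷ [] , divides-refl 1 , λ _ → ≡.refl) , record
      { distinct = dist
      ; p↦q = ≡.trans (≡.cong second (transpose-first a b)) (transpose-other (a≢b ∘ ≡.sym) b≢d)
      ; q↦r = ≡.trans (≡.cong second (transpose-second a b)) (transpose-first a d)
      ; r↦p = ≡.trans (≡.cong second (transpose-other d≢a (b≢d ∘ ≡.sym))) (transpose-second a d)
      ; fixed = λ x x≢a x≢b x≢d → ≡.trans (≡.cong second (transpose-other x≢a x≢b)) (transpose-other x≢a x≢d)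
      }
    where
    ts : TranspositionList n
    ts = (a , b) ∷ (a , d) ∷ []
    second : Fin n → Fin n
    second = PC.transpose a d

  ∼⇒cycle : ∀ {i j} → to i ∼ to j → ∃[ p ] ∃[ q ] ∃[ r ] CycleStep (val i) (val j) p q r
  ∼⇒cycle {i} {j} (t , (p , q , r , p<q , q<r , cycle) , j≈ti) = oriented cycle
    where
    p≢q = <⇒≢ p<q
    q≢r = <⇒≢ q<r
    p≢r = <⇒≢ (<-trans p<q q<r)
    step : ∀ {x y z} → Distinct₃ x y z → IsCycle x y z (proj₁ t) → CycleStep (val i) (val j) x y z
    step dist (x↦y , y↦z , z↦x , fixed) = record
      { distinct = dist
      ; p↦q = ≡.trans (j≈ti _) (≡.cong (val i) x↦y)
      ; q↦r = ≡.trans (j≈ti _) (≡.cong (val i) y↦z)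
      ; r↦p = ≡.trans (j≈ti _) (≡.cong (val i) z↦x)
      ; fixed = λ w w≢x w≢y w≢z → ≡.trans (j≈ti w) (≡.cong (val i) (fixed w w≢x w≢y w≢z))
      }
    oriented : IsCycle p q r (proj₁ t) ⊎ IsCycle p r q (proj₁ t) → ∃[ p ] ∃[ q ] ∃[ r ] CycleStep (val i) (val j) p q r
    oriented (inj₁ c) = p , q , r , step (p≢q , q≢r , p≢r ∘ ≡.sym) c
    oriented (inj₂ c) = p , r , q , step (p≢r , q≢r ∘ ≡.sym , p≢q ∘ ≡.sym) c

  cycle⇒∼ : ∀ {i j p q r} → Distinct₃ p q r → i ≢ j →
            (∀ x → x ≢ p → x ≢ q → x ≢ r → val i x ≡ val j x) → to i ∼ to j
  cycle⇒∼ {i} {j} {p} {q} {r} dist@(p≢q , q≢r , r≢p) i≢j agree = t , t∈T₃ , λ x → ≡.sym (Perm.inverseʳ (proj₁ (to i)))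
    where
    t : Carrier
    -- Left to right, t times `to i` is `to j`, as an edge requires; pointwise t applies `j` and
    -- then undoes `i`.
    t = to j ∙ to i ⁻¹
    π : Permutation′ n
    π = proj₁ t
    fixed : ∀ x → x ≢ p → x ≢ q → x ≢ r → π ⟨$⟩ʳ x ≡ x
    fixed x x≢p x≢q x≢r = ≡.trans (≡.cong (proj₁ (to i) ⟨$⟩ˡ_) (≡.sym (agree x x≢p x≢q x≢r))) (Perm.inverseˡ (proj₁ (to i)))
    π≉id : ¬ (∀ x → π ⟨$⟩ʳ x ≡ x)
    π≉id π≈id = i≢j (val-extensional λ x →
      ≡.trans (≡.cong (val i) (≡.sym (π≈id x))) (Perm.inverseʳ (proj₁ (to i))))
    t∈T₃ : T₃ t
    t∈T₃ with even-cycle {π = π} (proj₂ t) dist fixed π≉id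
    ... | inj₁ c = cycle∈T₃ {π = π} (proj₂ t) dist c
    ... | inj₂ c = cycle∈T₃ {π = π} (proj₂ t) (r≢p ∘ ≡.sym , q≢r ∘ ≡.sym , p≢q ∘ ≡.sym) c

  family : PermutationFamily n N
  family = record
    { val = val
    ; val-injective = λ i → permutation-injective (proj₁ (to i))
    ; val-surjective = λ i y → proj₁ (to i) ⟨$⟩ˡ y , Perm.inverseʳ (proj₁ (to i))
    ; val-extensional = val-extensional
    ; translate = λ i j → rightTranslation (to i ⁻¹ ∙ to j) ,
        λ x → ≡.cong (val j) (≡.sym (Perm.inverseˡ (proj₁ (to i))))
    ; rotate = rotate
    ; _∼_ = λ i j → to i ∼ to j
    ; _∼?_ = λ i j → to i ∼? to j
    ; ∼-sym = λ {i} {j} → ∼-sym {to i} {to j}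
    ; ∼⇒cycle = ∼⇒cycle
    ; cycle⇒∼ = cycle⇒∼
    }

-- Binomial coefficients and the closed forms of the two eigenvalues.

2*nC2 : ∀ m → 2 ℕ.* ((2 ℕ.+ m) C 2) ≡ (2 ℕ.+ m) ℕ.* (1 ℕ.+ m)
2*nC2 zero    = ≡.refl
2*nC2 (suc m) = begin
  2 ℕ.* ((3 ℕ.+ m) C 2)                        ≡⟨ ≡.cong (2 ℕ.*_) (nCk+nC[k+1]≡[n+1]C[k+1] (2 ℕ.+ m) 1) ⟨
  2 ℕ.* ((2 ℕ.+ m) C 1 ℕ.+ (2 ℕ.+ m) C 2)      ≡⟨ ≡.cong (λ x → 2 ℕ.* (x ℕ.+ (2 ℕ.+ m) C 2)) (nC1≡n (2 ℕ.+ m)) ⟩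
  2 ℕ.* ((2 ℕ.+ m) ℕ.+ (2 ℕ.+ m) C 2)          ≡⟨ solve 2 (λ m x → con 2 :* ((con 2 :+ m) :+ x) := con 2 :* (con 2 :+ m) :+ con 2 :* x) ≡.refl m ((2 ℕ.+ m) C 2) ⟩
  2 ℕ.* (2 ℕ.+ m) ℕ.+ 2 ℕ.* ((2 ℕ.+ m) C 2)    ≡⟨ ≡.cong (2 ℕ.* (2 ℕ.+ m) ℕ.+_) (2*nC2 m) ⟩
  2 ℕ.* (2 ℕ.+ m) ℕ.+ (2 ℕ.+ m) ℕ.* (1 ℕ.+ m)  ≡⟨ solve 1 (λ m → con 2 :* (con 2 :+ m) :+ (con 2 :+ m) :* (con 1 :+ m) := (con 3 :+ m) :* (con 2 :+ m)) ≡.refl m ⟩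
  (3 ℕ.+ m) ℕ.* (2 ℕ.+ m)                      ∎
  where
  open ≡.≡-Reasoning
  open +-*-Solver

3*2*nC3 : ∀ m → 3 ℕ.* (2 ℕ.* ((3 ℕ.+ m) C 3)) ≡ (3 ℕ.+ m) ℕ.* (2 ℕ.+ m) ℕ.* (1 ℕ.+ m)
3*2*nC3 zero    = ≡.refl
3*2*nC3 (suc m) = begin
  3 ℕ.* (2 ℕ.* ((4 ℕ.+ m) C 3))
    ≡⟨ ≡.cong (λ x → 3 ℕ.* (2 ℕ.* x)) (nCk+nC[k+1]≡[n+1]C[k+1] (3 ℕ.+ m) 2) ⟨
  3 ℕ.* (2 ℕ.* ((3 ℕ.+ m) C 2 ℕ.+ (3 ℕ.+ m) C 3))
    ≡⟨ solve 2 (λ x y → con 3 :* (con 2 :* (x :+ y)) := con 3 :* (con 2 :* x) :+ con 3 :* (con 2 :* y)) ≡.refl ((3 ℕ.+ m) C 2) ((3 ℕ.+ m) C 3) ⟩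
  3 ℕ.* (2 ℕ.* ((3 ℕ.+ m) C 2)) ℕ.+ 3 ℕ.* (2 ℕ.* ((3 ℕ.+ m) C 3))
    ≡⟨ ≡.cong₂ (λ x y → 3 ℕ.* x ℕ.+ y) (2*nC2 (suc m)) (3*2*nC3 m) ⟩
  3 ℕ.* ((3 ℕ.+ m) ℕ.* (2 ℕ.+ m)) ℕ.+ (3 ℕ.+ m) ℕ.* (2 ℕ.+ m) ℕ.* (1 ℕ.+ m)
    ≡⟨ solve 1 (λ m → con 3 :* ((con 3 :+ m) :* (con 2 :+ m)) :+ (con 3 :+ m) :* (con 2 :+ m) :* (con 1 :+ m)
         := (con 4 :+ m) :* (con 3 :+ m) :* (con 2 :+ m)) ≡.refl m ⟩
  (4 ℕ.+ m) ℕ.* (3 ℕ.+ m) ℕ.* (2 ℕ.+ m) ∎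
  where
  open ≡.≡-Reasoning
  open +-*-Solver

theorem3p4 : ∀ {c ℓ₁ ℓ₂} (K : OrderedField c ℓ₁ ℓ₂) →
    let open OrderedField K
        open Spectra K in
    (n : ℕ) → 3 ℕ.≤ n →
    (N : ℕ) (lab : Graph.Labelling (CAG n) N) (λs : List Carrier) →
    IsSpectrum (adjacencyMatrix (CAG n) lab) λs →
    Prefix _≈_
      ( fromℕ (2 ℕ.* (n C 3))
      ∷ fromℕ 3 ⁻¹ * (fromℕ n * (fromℕ n - fromℕ 2) * (fromℕ n - fromℕ 4))
      ∷ [])
      λs
theorem3p4 K (suc (suc (suc m))) (s≤s (s≤s (s≤s _))) N lab λs spectrum =
  rescaled (α-largest-two 3d≈ λs spectrum)
  where
  open FieldProperties K
  open Solver using (solve; _:=_; _:+_; _:*_; _:-_; con)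
  open AlternatingFamily lab using (family)
  -- The label of the identity serves as the base point `o`.
  open Eigenvalues K family (Inverse.from lab (Group.ε (A (3 ℕ.+ m))))
  open SetoidReasoning setoid

  n n-1 n-2 d : Carrier
  n   = fromℕ (3 ℕ.+ m)
  n-1 = fromℕ (2 ℕ.+ m)
  n-2 = fromℕ (1 ℕ.+ m)
  d   = fromℕ (2 ℕ.* ((3 ℕ.+ m) C 3))

  3d≈ : fromℕ 3 * d ≈ n * n-1 * n-2
  3d≈ = begin
    fromℕ 3 * d                                            ≈⟨ fromℕ-* 3 (2 ℕ.* ((3 ℕ.+ m) C 3)) ⟨
    fromℕ (3 ℕ.* (2 ℕ.* ((3 ℕ.+ m) C 3)))                  ≡⟨ ≡.cong fromℕ (3*2*nC3 m) ⟩
    fromℕ ((3 ℕ.+ m) ℕ.* (2 ℕ.+ m) ℕ.* (1 ℕ.+ m))          ≈⟨ fromℕ-* ((3 ℕ.+ m) ℕ.* (2 ℕ.+ m)) (1 ℕ.+ m) ⟩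
    fromℕ ((3 ℕ.+ m) ℕ.* (2 ℕ.+ m)) * n-2                  ≈⟨ *-congʳ (fromℕ-* (3 ℕ.+ m) (2 ℕ.+ m)) ⟩
    n * n-1 * n-2                                          ∎

  second-eigenvalue : fromℕ 3 ⁻¹ * (n * (n - fromℕ 2) * (n - fromℕ 4)) ≈ d - n * n-2
  second-eigenvalue = *-cancelˡ (fromℕ≉0 2) (begin
    fromℕ 3 * (fromℕ 3 ⁻¹ * (n * (n - fromℕ 2) * (n - fromℕ 4)))
      ≈⟨ *-assoc _ _ _ ⟨
    fromℕ 3 * fromℕ 3 ⁻¹ * (n * (n - fromℕ 2) * (n - fromℕ 4))
      ≈⟨ *-congʳ (⁻¹-inverse (fromℕ 3) (fromℕ≉0 2)) ⟩
    1# * (n * (n - fromℕ 2) * (n - fromℕ 4))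
      -- This is n(n - 2)(n - 4) = n(n - 1)(n - 2) - 3n(n - 2). The numerals are spelled out as
      -- nested sums ending in 0 because that is how `fromℕ` unfolds.
      ≈⟨ solve 1 (λ x → let one = con (+ 1) ; two = one :+ (one :+ con (+ 0)) ; n = one :+ (one :+ (one :+ x)) in
           one :* (n :* (n :- two) :* (n :- (one :+ (one :+ two)))) :=
           n :* (one :+ (one :+ x)) :* (one :+ x) :- (one :+ two) :* (n :* (one :+ x))) refl (fromℕ m) ⟩
    n * n-1 * n-2 - fromℕ 3 * (n * n-2)
      ≈⟨ +-congʳ 3d≈ ⟨
    fromℕ 3 * d - fromℕ 3 * (n * n-2)
      ≈⟨ solve 3 (λ t d x → t :* d :- t :* x := t :* (d :- x)) refl (fromℕ 3) d (n * n-2) ⟩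
    fromℕ 3 * (d - n * n-2) ∎)

  rescaled : ∀ {xs} → Prefix _≈_ (d ∷ (d - n * n-2) ∷ []) xs →
             Prefix _≈_ (d ∷ fromℕ 3 ⁻¹ * (n * (n - fromℕ 2) * (n - fromℕ 4)) ∷ []) xs
  rescaled (d≈x ∷ θ≈y ∷ []) = d≈x ∷ trans second-eigenvalue θ≈y ∷ []
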